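{- Let $\Delta$ be either the Paley graph $P(q)$, where $q$ is a prime power satisfying $q\equiv 1\pmod 4$, or the Peisert graph $P^*(q)$, where $q=p^r\ge 5$ is a power of a prime $p$ with $p\equiv 3\pmod 4$ and $r$ even. Let $\Sigma$ be the Taylor extension of $\Delta$, and let $\Gamma$ be the bipartite double of $\Sigma$. Then $\Gamma$ is a connected bipartite amply regular graph with diameter $d=4$ and parameters $(v,k,\lambda,\mu)=\left(4(q+1),\,q,\,0,\,\frac{q-1}{2}\right)$, and $\Gamma$ is a $Q$-regular graph with distribution diagram $\mathcal Q_k$ (defined in the context) with $k=q$.
   Context: All graphs are finite, simple and undirected. An amply regular graph with parameters $(v,k,\lambda,\mu)$ is a $k$-regular graph on $v$ vertices such that every pair of adjacent vertices has exactly $\lambda$ common neighbors and every pair of vertices at distance two has exactly $\mu$ common neighbors. Paley graph $P(q)$: vertex set $\mathbb F_q$, distinct $x,y$ adjacent iff $x-y$ is a nonzero square in $\mathbb F_q$. Peisert graph $P^*(q)$: vertex set $\mathbb F_q$, distinct $x,y$ adjacent iff $x-y\in\{w^j: j\equiv 0,1 \pmod 4\}$, where $w$ is a primitive root of $\mathbb F_q$. Taylor double of a graph $\Delta'$: the graph with vertex set $\{x^{\varepsilon}: x\in V(\Delta'),\ \varepsilon=\pm1\}$ in which $x^\delta$ and $y^\varepsilon$ with $x\ne y$ are adjacent iff $\delta\varepsilon=1$ when $x\sim y$ in $\Delta'$, and $\delta\varepsilon=-1$ when $x\not\sim y$ in $\Delta'$ (and $x^{+1},x^{ -1}$ are not adjacent).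 Taylor extension of $\Delta$: the Taylor double of the graph obtained from $\Delta$ by adding a new vertex $\infty$ adjacent to every vertex of $\Delta$. Bipartite double of a graph $\Sigma$: vertex set $V(\Sigma)\times\{0,1\}$, with $(x,i)\sim(y,j)$ iff $x\sim y$ in $\Sigma$ and $i\ne j$. A partition $\{B_1,\dots,B_n\}$ of $V(\Gamma)$ is equitable with quotient matrix $Q=(q_{ij})$ if every vertex of $B_i$ has exactly $q_{ij}$ neighbors in $B_j$, for all $i,j$. The distribution diagram of the partition records the sizes $|B_i|$ and the numbers $q_{ij}$ (it is used interchangeably with the quotient matrix). $\Gamma$ is $Q$-regular if for each vertex $x$ there is an equitable partition of $V(\Gamma)$ with quotient matrix $Q$ such that $\{x\}$ is a part. The distribution diagram $\mathcal Q_k$ has six cells $P_0,P_1,P_2,P_3,P_4,P_5$ of sizes $1,\ k,\ 2k,\ k,\ 1,\ 2$ respectively, with $P_0=\{x\}$, and with the following quotient numbers (all unlisted ones are $0$): $q_{01}=k$; $q_{10}=1$, $q_{12}=k-1$; $q_{21}=\frac{k-1}{2}$, $q_{23}=\frac{k-1}{2}$, $q_{25}=1$; $q_{32}=k-1$, $q_{34}=1$; $q_{43}=k$; $q_{52}=k$. -}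

module Defs where

open import Algebra.Bundles using (CommutativeRing)
open import Algebra.Structures using (IsCommutativeRing)
open import Data.Bool.Base using (Bool)
open import Data.Empty using (⊥)
open import Data.Fin.Base as Fin using (Fin; zero; suc; toℕ; fromℕ<; punchOut)
open import Data.Fin.Patterns using (0F)
import Data.Fin.Properties as Fin
open import Data.List.Base using (List; []; _∷_; _++_; length; tabulate; foldr)
open import Data.List.Membership.Propositional using (_∈_)
open import Data.List.Membership.Propositional.Properties using (∈-∃++; ∈-tabulate⁺)
open import Data.List.Properties using (length-tabulate)
import Data.List.Relation.Unary.All as All
import Data.List.Relation.Unary.AllPairs as AllPairs
open import Data.List.Relation.Unary.Any using (here; there)
open import Data.List.Relation.Unary.Unique.Propositional using (Unique)
import Data.List.Relation.Unary.Unique.Propositional.Properties as Unique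
open import Data.List.Relation.Binary.Permutation.Propositional using (_↭_; prep; ↭-refl; ↭-sym; ↭-trans; ↭-reflexive; ↭⇒↭ₛ)
open import Data.List.Relation.Binary.Permutation.Propositional.Properties using (shift; ↭-length; ∈-resp-↭)
import Data.List.Relation.Binary.Permutation.Setoid.Properties as Permₛ
open import Data.Maybe.Base using (Maybe; just; nothing)
open import Data.Nat.Base using (ℕ; zero; suc; _≤_; _<_; _≥_; s≤s; NonZero; >-nonZero)
open import Data.Nat.DivMod using (_/_; _%_; m≡m%n+[m/n]*n; m%n<n; [m+kn]%n≡m%n)
open import Data.Nat.Divisibility using (_∣_; divides; ∣-trans; *-cancelˡ-∣; n∣m*n; m%n≡0⇒n∣m)
open import Data.Nat.Primality using (Prime)
import Data.Nat.Base as ℕ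
import Data.Nat.Properties as ℕ
open import Data.Nat.Tactic.RingSolver using (solve-∀)
open import Data.Product.Base using (Σ; ∃; ∃₂; _×_; _,_; proj₁; proj₂)
open import Data.Product.Function.NonDependent.Propositional using (_×-↔_)
open import Data.Sign.Base as Sign using (Sign)
import Data.Sign.Properties as Sign
open import Data.Sum.Base using (_⊎_; inj₁; inj₂)
open import Data.Unit.Base using (⊤; tt)
open import Data.Vec.Base using (Vec; []; _∷_; lookup)
open import Function.Base using (_∘_; id)
open import Function.Bundles using (_↔_; _⇔_; mk↔ₛ′; Inverse)
open import Function.Properties.Inverse using (↔-sym; ↔-trans)
open import Level using (0ℓ)
open import Relation.Binary.Definitions using (DecidableEquality)
open import Relation.Binary.PropositionalEquality
open import Relation.Nullary using (¬_; yes; no; contradiction)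
open import Relation.Nullary.Decidable using (map′)

record Graph : Set₁ where
  infix 4 _∼_
  field
    V           : Set
    _∼_         : V → V → Set
    ∼-sym       : ∀ {x y} → x ∼ y → y ∼ x
    ∼-irrefl    : ∀ {x} → ¬ (x ∼ x)
    order       : ℕ
    enumeration : V ↔ Fin order

HasSize : {A : Set} → (A → Set) → ℕ → Set
HasSize {A} P n = Σ (List A) λ xs → Unique xs × (∀ x → (x ∈ xs) ⇔ P x) × length xs ≡ n

module _ (G : Graph) where
  open Graph G

  data Walk : V → V → ℕ → Set where
    []  : ∀ {x} → Walk x x 0
    _∷_ : ∀ {x y z n} → x ∼ y → Walk y z n → Walk x z (suc n)

  Distance : V → V → ℕ → Set
  Distance x y n = Walk x y n × (∀ m → Walk x y m → n ≤ m)

  Connected : Set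
  Connected = ∀ x y → ∃ λ n → Walk x y n

  Bipartite : Set
  Bipartite = Σ (V → Bool) λ side → ∀ {x y} → x ∼ y → side x ≢ side y

  HasDiameter : ℕ → Set
  HasDiameter d = (∀ x y → ∃ λ n → n ≤ d × Distance x y n)
                × (∃₂ λ x y → Distance x y d)

  CommonNeighbour : V → V → V → Set
  CommonNeighbour x y z = x ∼ z × y ∼ z

  record IsAmplyRegular (v k λ′ μ : ℕ) : Set where
    field
      order-v   : order ≡ v
      k-regular : ∀ x → HasSize (x ∼_) k
      adjacent  : ∀ {x y} → x ∼ y → HasSize (CommonNeighbour x y) λ′
      distance2 : ∀ {x y} → Distance x y 2 → HasSize (CommonNeighbour x y) μ

  -- The partition {B_i} is encoded by the map sending a vertex to the index
  -- of its part.
  record IsEquitable {n} (part : V → Fin n) (Q : Fin n → Fin n → ℕ) : Set where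
    field
      nonempty : ∀ i → ∃ λ x → part x ≡ i
      quotient : ∀ x j → HasSize (λ y → x ∼ y × part y ≡ j) (Q (part x) j)

-- root is the index of the part {x}.
record DistributionDiagram : Set where
  field
    cells    : ℕ
    root     : Fin cells
    size     : Fin cells → ℕ
    quotient : Fin cells → Fin cells → ℕ

QRegular : Graph → DistributionDiagram → Set
QRegular G D = ∀ x → Σ (V → Fin cells) λ part →
    IsEquitable G part quotient
  × (∀ i → HasSize (λ y → part y ≡ i) (size i))
  × (∀ y → part y ≡ root ⇔ y ≡ x)
  where open Graph G; open DistributionDiagram D

𝒬 : ℕ → DistributionDiagram
𝒬 k = record
  { cells    = 6
  ; root     = 0F
  ; size     = lookup (1 ∷ k ∷ 2 ℕ.* k ∷ k ∷ 1 ∷ 2 ∷ [])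
  ; quotient = λ i j → lookup (lookup matrix i) j
  }
  where
  k-1 = k ℕ.∸ 1
  h   = (k ℕ.∸ 1) / 2

  matrix : Vec (Vec ℕ 6) 6
  matrix = (0 ∷ k ∷ 0   ∷ 0 ∷ 0 ∷ 0 ∷ [])
         ∷ (1 ∷ 0 ∷ k-1 ∷ 0 ∷ 0 ∷ 0 ∷ [])
         ∷ (0 ∷ h ∷ 0   ∷ h ∷ 0 ∷ 1 ∷ [])
         ∷ (0 ∷ 0 ∷ k-1 ∷ 0 ∷ 1 ∷ 0 ∷ [])
         ∷ (0 ∷ 0 ∷ 0   ∷ k ∷ 0 ∷ 0 ∷ [])
         ∷ (0 ∷ 0 ∷ k   ∷ 0 ∷ 0 ∷ 0 ∷ [])
         ∷ []

Sign↔Fin2 : Sign ↔ Fin 2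
Sign↔Fin2 = mk↔ₛ′
  (λ { Sign.- → zero ; Sign.+ → suc zero })
  (λ { zero → Sign.- ; (suc zero) → Sign.+ })
  (λ { zero → refl ; (suc zero) → refl })
  (λ { Sign.- → refl ; Sign.+ → refl })

Maybe↔Fin : ∀ {A : Set} {n} → A ↔ Fin n → Maybe A ↔ Fin (suc n)
Maybe↔Fin {A} {n} e = mk↔ₛ′ f g fg gf
  where
  open Inverse e
  f : Maybe A → Fin (suc n)
  f nothing  = zero
  f (just x) = suc (to x)
  g : Fin (suc n) → Maybe A
  g zero    = nothing
  g (suc i) = just (from i)
  fg : ∀ i → f (g i) ≡ i
  fg zero    = refl
  fg (suc i) = cong suc (strictlyInverseˡ i)
  gf : ∀ m → g (f m) ≡ m
  gf nothing  = refl
  gf (just x) = cong just (strictlyInverseʳ x)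

×↔Fin : ∀ {A B : Set} {m n} → A ↔ Fin m → B ↔ Fin n → (A × B) ↔ Fin (m ℕ.* n)
×↔Fin e e′ = ↔-trans (e ×-↔ e′) (↔-sym Fin.*↔×)

taylorDouble : Graph → Graph
taylorDouble G = record
  { V           = V × Sign
  ; _∼_         = Adj
  ; ∼-sym       = λ { {_ , δ} {_ , ε} (x≢y , adj) → (x≢y ∘ sym) , flipAdj δ ε adj }
  ; ∼-irrefl    = λ adj → proj₁ adj refl
  ; order       = order ℕ.* 2
  ; enumeration = ×↔Fin enumeration Sign↔Fin2
  }
  where
  open Graph G

  Adj : V × Sign → V × Sign → Set
  Adj (x , δ) (y , ε) = x ≢ y ×
    ( (x ∼ y      × δ Sign.* ε ≡ Sign.+)
    ⊎ (¬ (x ∼ y)  × δ Sign.* ε ≡ Sign.-) )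

  flipAdj : ∀ {x y} δ ε →
    (x ∼ y × δ Sign.* ε ≡ Sign.+) ⊎ (¬ (x ∼ y) × δ Sign.* ε ≡ Sign.-) →
    (y ∼ x × ε Sign.* δ ≡ Sign.+) ⊎ (¬ (y ∼ x) × ε Sign.* δ ≡ Sign.-)
  flipAdj δ ε (inj₁ (a , s)) = inj₁ (∼-sym a , trans (Sign.*-comm ε δ) s)
  flipAdj δ ε (inj₂ (a , s)) = inj₂ ((a ∘ ∼-sym) , trans (Sign.*-comm ε δ) s)

-- The new vertex ∞ is nothing.
cone : Graph → Graph
cone G = record
  { V           = Maybe V
  ; _∼_         = Adj
  ; ∼-sym       = λ {x} {y} → adj-sym x y
  ; ∼-irrefl    = λ {x} → adj-irrefl x
  ; order       = suc order
  ; enumeration = Maybe↔Fin enumeration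
  }
  where
  open Graph G

  Adj : Maybe V → Maybe V → Set
  Adj nothing  nothing  = ⊥
  Adj nothing  (just _) = ⊤
  Adj (just _) nothing  = ⊤
  Adj (just x) (just y) = x ∼ y

  adj-sym : ∀ x y → Adj x y → Adj y x
  adj-sym nothing  (just _) _ = tt
  adj-sym (just _) nothing  _ = tt
  adj-sym (just _) (just _) a = ∼-sym a

  adj-irrefl : ∀ x → ¬ Adj x x
  adj-irrefl (just _) a = ∼-irrefl a

taylorExtension : Graph → Graph
taylorExtension G = taylorDouble (cone G)

bipartiteDouble : Graph → Graph
bipartiteDouble G = record
  { V           = V × Fin 2
  ; _∼_         = λ (x , i) (y , j) → x ∼ y × i ≢ j
  ; ∼-sym       = λ (a , i≢j) → ∼-sym a , i≢j ∘ sym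
  ; ∼-irrefl    = λ (a , _) → ∼-irrefl a
  ; order       = order ℕ.* 2
  ; enumeration = ×↔Fin enumeration (mk↔ₛ′ id id (λ _ → refl) (λ _ → refl))
  }
  where open Graph G

record FiniteField (q : ℕ) : Set₁ where
  infixl 7 _*_
  infixl 6 _+_
  infix  8 -_
  field
    Carrier           : Set
    _+_ _*_           : Carrier → Carrier → Carrier
    -_                : Carrier → Carrier
    0# 1#             : Carrier
    isCommutativeRing : IsCommutativeRing _≡_ _+_ _*_ -_ 0# 1#
    0≢1               : 0# ≢ 1#
    inverse           : ∀ x → x ≢ 0# → ∃ λ y → x * y ≡ 1#
    enumeration       : Carrier ↔ Fin q

  commutativeRing : CommutativeRing 0ℓ 0ℓ
  commutativeRing = record { isCommutativeRing = isCommutativeRing }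

  open CommutativeRing commutativeRing public
    using (_-_; semiring; ring; +-group; +-comm; +-assoc; *-comm; *-assoc; *-identityˡ; *-identityʳ;
           +-identityˡ; +-identityʳ; zeroˡ; zeroʳ; distribˡ; distribʳ; -‿inverseˡ; -‿inverseʳ)
  open import Algebra.Properties.Semiring.Exp semiring public using (_^_; ^-homo-*; ^-assocʳ)

  IsNonzeroSquare : Carrier → Set
  IsNonzeroSquare a = a ≢ 0# × ∃ λ s → a ≡ s * s

  IsPrimitiveRoot : Carrier → Set
  IsPrimitiveRoot w = w ≢ 0# × (∀ x → x ≢ 0# → ∃ λ j → x ≡ w ^ j)

module _ {A : Set} where

  Unique-resp-↭ : ∀ {xs ys : List A} → xs ↭ ys → Unique xs → Unique ys
  Unique-resp-↭ p = Permₛ.Unique-resp-↭ (setoid A) (↭⇒↭ₛ p)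

  extract : ∀ {x : A} {xs} → x ∈ xs → ∃ λ ys → xs ↭ x ∷ ys
  extract x∈xs with ys , zs , eq ← ∈-∃++ x∈xs =
    ys ++ zs , ↭-trans (↭-reflexive eq) (shift _ ys zs)

  head∉tail : ∀ {x y : A} {xs} → Unique (x ∷ xs) → y ∈ xs → x ≢ y
  head∉tail (x∉ AllPairs.∷ _) y∈ = All.lookup x∉ y∈

  tail∈ : ∀ {x y : A} {xs} → y ∈ (x ∷ xs) → x ≢ y → y ∈ xs
  tail∈ (here eq) x≢y = contradiction (sym eq) x≢y
  tail∈ (there p) _   = p

  data Paired (f : A → A) : List A → Set where
    []   : Paired f []
    pair : ∀ x {xs} → Paired f xs → Paired f (x ∷ f x ∷ xs)

  pairing : ∀ (f : A → A) n xs → length xs ≤ n → Unique xs →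
    (∀ {x} → x ∈ xs → f x ∈ xs) → (∀ {x} → x ∈ xs → f (f x) ≡ x) → (∀ {x} → x ∈ xs → f x ≢ x) →
    ∃ λ ys → xs ↭ ys × Paired f ys
  pairing f n [] _ _ _ _ _ = [] , ↭-refl , []
  pairing f (suc n) (x ∷ xs) (s≤s len) u closed invol free
    with ys , p ← extract (tail∈ (closed (here refl)) (free (here refl) ∘ sym)) =
    let u′          = Unique-resp-↭ (prep x p) u
        old         = λ {z} (z∈ : z ∈ ys) → ∈-resp-↭ (↭-sym (prep x p)) (there (there z∈))
        x≢          = λ {z} (z∈ : z ∈ ys) → head∉tail u′ (there z∈)
        fx≢         = λ {z} (z∈ : z ∈ ys) → head∉tail (AllPairs.tail u′) z∈
        closed′     = λ {z} (z∈ : z ∈ ys) →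
          tail∈ (tail∈ (∈-resp-↭ (prep x p) (closed (old z∈)))
                  (λ x≡fz → fx≢ z∈ (trans (cong f x≡fz) (invol (old z∈)))))
                (λ fx≡fz → x≢ z∈ (trans (sym (invol (here refl))) (trans (cong f fx≡fz) (invol (old z∈)))))
        zs , r , pd = pairing f n ys
          (ℕ.≤-trans (ℕ.n≤1+n _) (subst (_≤ n) (↭-length p) len))
          (AllPairs.tail (AllPairs.tail u′)) closed′ (invol ∘ old) (free ∘ old)
    in x ∷ f x ∷ zs , ↭-trans (prep x p) (prep x (prep (f x) r)) , pair x pd

  half : ∀ {f xs} → Paired f xs → ℕ
  half []         = 0
  half (pair _ p) = suc (half p)

  half-length : ∀ {f xs} (p : Paired f xs) → length xs ≡ half p ℕ.* 2
  half-length []         = refl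
  half-length (pair _ p) = cong (2 ℕ.+_) (half-length p)

-- A Wilson-type argument makes -1 a square when q ≡ 1 (mod 4), and -1 is a
-- fourth power when q ≡ 1 (mod 8); hence adjacency in the Paley and Peisert
-- graphs is symmetric.
module FieldFacts {q : ℕ} (F : FiniteField q) where
  open FiniteField F
  open Inverse enumeration using (to; from; strictlyInverseˡ; strictlyInverseʳ)
  open import Algebra.Properties.Ring ring
    using (-‿distribˡ-*; -‿distribʳ-*; -1*x≈-x)
  open import Algebra.Properties.Group +-group using ()
    renaming (⁻¹-involutive to neg-involutive; ⁻¹-injective to neg-injective; ε⁻¹≈ε to -0≡0;
              x∙y⁻¹≈ε⇒x≈y to x-y≡0⇒x≡y; inverseˡ-unique to +-inverseˡ-unique)
  open ≡-Reasoning

  to-injective : ∀ {x y} → to x ≡ to y → x ≡ y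
  to-injective {x} {y} eq = trans (sym (strictlyInverseʳ x)) (trans (cong from eq) (strictlyInverseʳ y))

  from-injective : ∀ {i j} → from i ≡ from j → i ≡ j
  from-injective {i} {j} eq = trans (sym (strictlyInverseˡ i)) (trans (cong to eq) (strictlyInverseˡ j))

  _≟_ : DecidableEquality Carrier
  x ≟ y = map′ to-injective (cong to) (to x Fin.≟ to y)

  cancelˡ : ∀ a {x y} → a ≢ 0# → a * x ≡ a * y → x ≡ y
  cancelˡ a {x} {y} a≢0 eq with b , ab≡1 ← inverse a a≢0 =
    trans (sym (lem x)) (trans (cong (b *_) eq) (lem y))
    where
    lem : ∀ z → b * (a * z) ≡ z
    lem z = trans (sym (*-assoc b a z)) (trans (cong (_* z) (trans (*-comm b a) ab≡1)) (*-identityˡ z))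

  nonzero-* : ∀ {x y} → x ≢ 0# → y ≢ 0# → x * y ≢ 0#
  nonzero-* {x} x≢0 y≢0 xy≡0 = y≢0 (cancelˡ x x≢0 (trans xy≡0 (sym (zeroʳ x))))

  nonzero-^ : ∀ {x} n → x ≢ 0# → x ^ n ≢ 0#
  nonzero-^ zero    x≢0 = 0≢1 ∘ sym
  nonzero-^ (suc n) x≢0 = nonzero-* x≢0 (nonzero-^ n x≢0)

  nonzero-neg : ∀ {x} → x ≢ 0# → - x ≢ 0#
  nonzero-neg x≢0 eq = x≢0 (neg-injective (trans eq (sym -0≡0)))

  neg*neg : ∀ x y → - x * - y ≡ x * y
  neg*neg x y = trans (sym (-‿distribˡ-* x (- y)))
    (trans (cong -_ (sym (-‿distribʳ-* x y))) (neg-involutive _))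

  elements : List Carrier
  elements = tabulate from

  elements-unique : Unique elements
  elements-unique = Unique.tabulate⁺ from-injective

  ∈-elements : ∀ x → x ∈ elements
  ∈-elements x = subst (_∈ elements) (strictlyInverseʳ x) (∈-tabulate⁺ (to x))

  nonzeros : ∃ λ xs → elements ↭ 0# ∷ xs
  nonzeros = extract (∈-elements 0#)

  ∏ : List Carrier → Carrier
  ∏ = foldr _*_ 1#

  ∏-↭ : ∀ {xs ys} → xs ↭ ys → ∏ xs ≡ ∏ ys
  ∏-↭ p = Permₛ.foldr-commMonoid (setoid Carrier) (CommutativeRing.*-isCommutativeMonoid commutativeRing) (↭⇒↭ₛ p)

  inv : Carrier → Carrier
  inv x with x ≟ 0#
  ... | yes _   = 0#
  ... | no  x≢0 = proj₁ (inverse x x≢0)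

  inv-* : ∀ {x} → x ≢ 0# → x * inv x ≡ 1#
  inv-* {x} x≢0 with x ≟ 0#
  ... | yes x≡0  = contradiction x≡0 x≢0
  ... | no  x≢0′ = proj₂ (inverse x x≢0′)

  inv-nonzero : ∀ {x} → x ≢ 0# → inv x ≢ 0#
  inv-nonzero {x} x≢0 eq = 0≢1 (trans (sym (zeroʳ x)) (trans (cong (x *_) (sym eq)) (inv-* x≢0)))

  inv-involutive : ∀ {x} → x ≢ 0# → inv (inv x) ≡ x
  inv-involutive {x} x≢0 = cancelˡ (inv x) (inv-nonzero x≢0)
    (trans (inv-* (inv-nonzero x≢0)) (trans (sym (inv-* x≢0)) (*-comm x (inv x))))

  square-one : ∀ {x} → x * x ≡ 1# → x ≢ 1# → x ≢ - 1# → ⊥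
  square-one {x} xx≡1 x≢1 x≢-1 = nonzero-*
    (x≢1 ∘ x-y≡0⇒x≡y x 1#)
    (λ x+1≡0 → x≢-1 (+-inverseˡ-unique x 1# x+1≡0)) (begin
      (x - 1#) * (x + 1#)               ≡⟨ distribˡ (x - 1#) x 1# ⟩
      (x - 1#) * x + (x - 1#) * 1#      ≡⟨ cong₂ _+_ (distribʳ x x (- 1#)) (*-identityʳ _) ⟩
      x * x + - 1# * x + (x - 1#)       ≡⟨ cong₂ (λ a b → a + b + (x - 1#)) xx≡1 (-1*x≈-x x) ⟩
      1# + - x + (x - 1#)               ≡⟨ +-assoc 1# (- x) (x - 1#) ⟩
      1# + (- x + (x - 1#))             ≡⟨ cong (1# +_) (sym (+-assoc (- x) x (- 1#))) ⟩
      1# + (- x + x + - 1#)             ≡⟨ cong (λ a → 1# + (a + - 1#)) (-‿inverseˡ x) ⟩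
      1# + (0# + - 1#)                  ≡⟨ cong (1# +_) (+-identityˡ (- 1#)) ⟩
      1# + - 1#                         ≡⟨ -‿inverseʳ 1# ⟩
      0#                                ∎)

  module _ (q≡1 : q % 4 ≡ 1) where

    q≡ : q ≡ 1 ℕ.+ q / 4 ℕ.* 4
    q≡ = trans (m≡m%n+[m/n]*n q 4) (cong (ℕ._+ q / 4 ℕ.* 4) q≡1)

    q-odd : ∀ n → q ≢ n ℕ.* 2
    q-odd n eq = ℕ.0≢1+n (begin
      0                                 ≡⟨ sym ([m+kn]%n≡m%n 0 n 2) ⟩
      (n ℕ.* 2) % 2                     ≡⟨ cong (_% 2) (trans (sym eq) q≡) ⟩
      (1 ℕ.+ q / 4 ℕ.* 4) % 2           ≡⟨ cong (λ z → (1 ℕ.+ z) % 2) (sym (ℕ.*-assoc (q / 4) 2 2)) ⟩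
      (1 ℕ.+ (q / 4 ℕ.* 2) ℕ.* 2) % 2   ≡⟨ [m+kn]%n≡m%n 1 (q / 4 ℕ.* 2) 2 ⟩
      1                                 ∎)

    1≢-1 : 1# ≢ - 1#
    1≢-1 1≡-1 = q-odd (half pd) (trans (sym (length-tabulate from)) (trans (↭-length p) (half-length pd)))
      where
      1+1≡0 : 1# + 1# ≡ 0#
      1+1≡0 = trans (cong (1# +_) 1≡-1) (-‿inverseʳ 1#)
      result = pairing (_+ 1#) (length elements) elements ℕ.≤-refl elements-unique
        (λ _ → ∈-elements _)
        (λ {x} _ → trans (+-assoc x 1# 1#) (trans (cong (x +_) 1+1≡0) (+-identityʳ x)))
        (λ {x} _ eq → 0≢1 (sym (begin
          1#                ≡⟨ sym (+-identityˡ 1#) ⟩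
          0# + 1#           ≡⟨ cong (_+ 1#) (sym (-‿inverseˡ x)) ⟩
          - x + x + 1#      ≡⟨ +-assoc (- x) x 1# ⟩
          - x + (x + 1#)    ≡⟨ cong (- x +_) eq ⟩
          - x + x           ≡⟨ -‿inverseˡ x ⟩
          0#                ∎)))
      p  = proj₁ (proj₂ result)
      pd = proj₂ (proj₂ result)

    x≢-x : ∀ {x} → x ≢ 0# → - x ≢ x
    x≢-x {x} x≢0 eq = 1≢-1 (cancelˡ x x≢0 (begin
      x * 1#     ≡⟨ *-identityʳ x ⟩
      x          ≡⟨ sym eq ⟩
      - x        ≡⟨ cong -_ (sym (*-identityʳ x)) ⟩
      - (x * 1#) ≡⟨ -‿distribʳ-* x 1# ⟩
      x * - 1#   ∎))

    N : List Carrier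
    N = proj₁ nonzeros

    N-unique : Unique (0# ∷ N)
    N-unique = Unique-resp-↭ (proj₂ nonzeros) elements-unique

    N-nonzero : ∀ {x} → x ∈ N → x ≢ 0#
    N-nonzero x∈ = head∉tail N-unique x∈ ∘ sym

    ∈-N : ∀ {x} → x ≢ 0# → x ∈ N
    ∈-N x≢0 = tail∈ (∈-resp-↭ (proj₂ nonzeros) (∈-elements _)) (x≢0 ∘ sym)

    length-N : length N ≡ q / 4 ℕ.* 4
    length-N = ℕ.suc-injective (trans (sym (↭-length (proj₂ nonzeros))) (trans (length-tabulate from) q≡))

    ∏-neg : ∀ {xs} (p : Paired -_ xs) → ∃ λ c → ∏ xs ≡ (- 1#) ^ half p * (c * c)
    ∏-neg [] = 1# , sym (trans (*-identityˡ _) (*-identityˡ _))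
    ∏-neg (pair x {xs} p) with c , eq ← ∏-neg p = x * c , (begin
      x * (- x * ∏ xs)                  ≡⟨ cong (λ z → x * (- x * z)) eq ⟩
      x * (- x * (e * (c * c)))         ≡⟨ cong (λ z → x * (z * (e * (c * c)))) (sym (-1*x≈-x x)) ⟩
      x * (- 1# * x * (e * (c * c)))    ≡⟨ cong (x *_) (interchange (- 1#) x e (c * c)) ⟩
      x * (- 1# * e * (x * (c * c)))    ≡⟨ x∙yz≈y∙xz x (- 1# * e) _ ⟩
      - 1# * e * (x * (x * (c * c)))    ≡⟨ cong (- 1# * e *_) (sym (*-assoc x x (c * c))) ⟩
      - 1# * e * (x * x * (c * c))      ≡⟨ cong (- 1# * e *_) (interchange x x c c) ⟩
      - 1# * e * (x * c * (x * c))      ∎)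
      where
      e = (- 1#) ^ half p
      open import Algebra.Properties.CommutativeSemigroup
        (CommutativeRing.*-commutativeSemigroup commutativeRing) using (interchange; x∙yz≈y∙xz)

    1^ : ∀ n → 1# ^ n ≡ 1#
    1^ zero    = refl
    1^ (suc n) = trans (*-identityˡ _) (1^ n)

    ∏N-square : ∃ λ c → ∏ N ≡ c * c
    ∏N-square with ys , p , pd ← pairing -_ (length N) N ℕ.≤-refl (AllPairs.tail N-unique)
                     (∈-N ∘ nonzero-neg ∘ N-nonzero) (λ _ → neg-involutive _) (x≢-x ∘ N-nonzero)
                with c , eq ← ∏-neg pd = c , (begin
      ∏ N                               ≡⟨ ∏-↭ p ⟩
      ∏ ys                              ≡⟨ eq ⟩
      (- 1#) ^ half pd * (c * c)        ≡⟨ cong (λ n → (- 1#) ^ n * (c * c)) half≡ ⟩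
      (- 1#) ^ (2 ℕ.* (q / 4)) * (c * c) ≡⟨ cong (_* (c * c)) (sym (^-assocʳ (- 1#) 2 (q / 4))) ⟩
      ((- 1#) ^ 2) ^ (q / 4) * (c * c)  ≡⟨ cong (λ z → z ^ (q / 4) * (c * c)) -1^2 ⟩
      1# ^ (q / 4) * (c * c)            ≡⟨ cong (_* (c * c)) (1^ (q / 4)) ⟩
      1# * (c * c)                      ≡⟨ *-identityˡ _ ⟩
      c * c                             ∎)
      where
      half≡ : half pd ≡ 2 ℕ.* (q / 4)
      half≡ = ℕ.*-cancelʳ-≡ _ _ 2 (begin
        half pd ℕ.* 2                   ≡⟨ sym (half-length pd) ⟩
        length ys                       ≡⟨ sym (↭-length p) ⟩
        length N                        ≡⟨ length-N ⟩
        q / 4 ℕ.* 4                     ≡⟨ sym (ℕ.*-assoc (q / 4) 2 2) ⟩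
        q / 4 ℕ.* 2 ℕ.* 2               ≡⟨ cong (ℕ._* 2) (ℕ.*-comm (q / 4) 2) ⟩
        2 ℕ.* (q / 4) ℕ.* 2             ∎)
      -1^2 : (- 1#) ^ 2 ≡ 1#
      -1^2 = trans (cong (- 1# *_) (*-identityʳ _)) (trans (neg*neg 1# 1#) (*-identityˡ 1#))

    ∏-inv : ∀ {xs} → Paired inv xs → (∀ {x} → x ∈ xs → x ≢ 0#) → ∏ xs ≡ 1#
    ∏-inv [] _ = refl
    ∏-inv (pair x {xs} p) nz = begin
      x * (inv x * ∏ xs)   ≡⟨ sym (*-assoc x (inv x) _) ⟩
      x * inv x * ∏ xs     ≡⟨ cong₂ _*_ (inv-* (nz (here refl))) (∏-inv p (nz ∘ there ∘ there)) ⟩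
      1# * 1#              ≡⟨ *-identityˡ 1# ⟩
      1#                   ∎

    wilson : ∏ N ≡ - 1#
    wilson
      with as , p ← extract (∈-N (0≢1 ∘ sym))
      with bs , r ← extract (tail∈ (∈-resp-↭ p (∈-N (nonzero-neg (0≢1 ∘ sym)))) 1≢-1) = begin
        ∏ N                    ≡⟨ ∏-↭ s ⟩
        1# * (- 1# * ∏ bs)     ≡⟨ *-identityˡ _ ⟩
        - 1# * ∏ bs            ≡⟨ cong (- 1# *_) ∏bs ⟩
        - 1# * 1#              ≡⟨ *-identityʳ _ ⟩
        - 1#                   ∎
      where
      s : N ↭ 1# ∷ - 1# ∷ bs
      s = ↭-trans p (prep 1# r)
      u : Unique (1# ∷ - 1# ∷ bs)
      u = Unique-resp-↭ s (AllPairs.tail N-unique)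
      inN : ∀ {x} → x ∈ bs → x ∈ N
      inN x∈ = ∈-resp-↭ (↭-sym s) (there (there x∈))
      nz : ∀ {x} → x ∈ bs → x ≢ 0#
      nz = N-nonzero ∘ inN
      ≢1 : ∀ {x} → x ∈ bs → 1# ≢ x
      ≢1 x∈ = head∉tail u (there x∈)
      ≢-1 : ∀ {x} → x ∈ bs → - 1# ≢ x
      ≢-1 x∈ = head∉tail (AllPairs.tail u) x∈
      inv-fix : ∀ {x c} → x ∈ bs → c * c ≡ 1# → c ≡ inv x → c ≡ x
      inv-fix {x} {c} x∈ cc≡1 refl = cancelˡ c (inv-nonzero (nz x∈))
        (trans cc≡1 (trans (sym (inv-* (nz x∈))) (*-comm x c)))
      closed : ∀ {x} → x ∈ bs → inv x ∈ bs
      closed x∈ = tail∈ (tail∈ (∈-resp-↭ s (∈-N (inv-nonzero (nz x∈))))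
        (≢1 x∈ ∘ inv-fix x∈ (*-identityˡ 1#)))
        (≢-1 x∈ ∘ inv-fix x∈ (trans (neg*neg 1# 1#) (*-identityˡ 1#)))
      ∏bs : ∏ bs ≡ 1#
      ∏bs with ys , t , pd ← pairing inv (length bs) bs ℕ.≤-refl (AllPairs.tail (AllPairs.tail u))
                  closed (inv-involutive ∘ nz)
                  (λ {x} x∈ eq → square-one (trans (cong (x *_) (sym eq)) (inv-* (nz x∈)))
                                   (≢1 x∈ ∘ sym) (≢-1 x∈ ∘ sym)) =
        trans (∏-↭ t) (∏-inv pd (nz ∘ ∈-resp-↭ (↭-sym t)))

    abstract
      -1-square : ∃ λ i → i * i ≡ - 1#
      -1-square = proj₁ ∏N-square , trans (sym (proj₂ ∏N-square)) wilson

    nonzeroSquare-neg : ∀ {x} → IsNonzeroSquare x → IsNonzeroSquare (- x)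
    nonzeroSquare-neg {x} (x≢0 , s , x≡ss) =
      nonzero-neg x≢0 , i * s , (begin
        - x                ≡⟨ sym (-1*x≈-x x) ⟩
        - 1# * x           ≡⟨ cong₂ _*_ (sym (proj₂ -1-square)) x≡ss ⟩
        i * i * (s * s)    ≡⟨ interchange i i s s ⟩
        i * s * (i * s)    ∎)
      where
      i = proj₁ -1-square
      open import Algebra.Properties.CommutativeSemigroup
        (CommutativeRing.*-commutativeSemigroup commutativeRing) using (interchange)

  module _ {w : Carrier} (prim : IsPrimitiveRoot w) where

    w^≢0 : ∀ n → w ^ n ≢ 0#
    w^≢0 n = nonzero-^ n (proj₁ prim)

    w^-cong-mod : ∀ e n .{{_ : NonZero e}} → w ^ e ≡ 1# → w ^ n ≡ w ^ (n % e)
    w^-cong-mod e n eq = begin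
      w ^ n                                  ≡⟨ cong (w ^_) (m≡m%n+[m/n]*n n e) ⟩
      w ^ (n % e ℕ.+ n / e ℕ.* e)            ≡⟨ ^-homo-* w (n % e) _ ⟩
      w ^ (n % e) * w ^ (n / e ℕ.* e)        ≡⟨ cong (λ z → w ^ (n % e) * w ^ z) (ℕ.*-comm (n / e) e) ⟩
      w ^ (n % e) * w ^ (e ℕ.* (n / e))      ≡⟨ cong (w ^ (n % e) *_) (sym (^-assocʳ w e (n / e))) ⟩
      w ^ (n % e) * (w ^ e) ^ (n / e)        ≡⟨ cong (λ z → w ^ (n % e) * z ^ (n / e)) eq ⟩
      w ^ (n % e) * 1# ^ (n / e)             ≡⟨ cong (w ^ (n % e) *_) (one^ (n / e)) ⟩
      w ^ (n % e) * 1#                       ≡⟨ *-identityʳ _ ⟩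
      w ^ (n % e)                            ∎
      where
      one^ : ∀ n → 1# ^ n ≡ 1#
      one^ zero    = refl
      one^ (suc n) = trans (*-identityˡ _) (one^ n)

    order-bound : ∀ e .{{_ : NonZero e}} → w ^ e ≡ 1# → q ≤ suc e
    order-bound e eq = Fin.injective⇒≤ {f = proj₁ ∘ index ∘ from} λ {i} {j} same →
      from-injective (trans (sym (proj₂ (index (from i))))
        (trans (cong power same) (proj₂ (index (from j)))))
      where
      power : Fin (suc e) → Carrier
      power zero    = 0#
      power (suc i) = w ^ toℕ i
      index : ∀ x → ∃ λ i → power i ≡ x
      index x with x ≟ 0#
      ... | yes x≡0 = zero , sym x≡0
      ... | no  x≢0 with j , x≡w^j ← proj₂ prim x x≢0 =
        suc (fromℕ< (m%n<n j e)) ,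
        trans (cong (w ^_) (Fin.toℕ-fromℕ< (m%n<n j e))) (trans (sym (w^-cong-mod e j eq)) (sym x≡w^j))

    w^∸ : ∀ {i j} → i < j → w ^ i ≡ w ^ j → w ^ (j ℕ.∸ i) ≡ 1#
    w^∸ {i} {j} i<j eq = cancelˡ (w ^ i) (w^≢0 i) (begin
      w ^ i * w ^ (j ℕ.∸ i)     ≡⟨ sym (^-homo-* w i _) ⟩
      w ^ (i ℕ.+ (j ℕ.∸ i))     ≡⟨ cong (w ^_) (ℕ.m+[n∸m]≡n (ℕ.<⇒≤ i<j)) ⟩
      w ^ j                     ≡⟨ sym eq ⟩
      w ^ i                     ≡⟨ sym (*-identityʳ _) ⟩
      w ^ i * 1#                ∎)

    module _ {n} (q≡1+n : q ≡ suc n) where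

      to′ : Carrier → Fin (suc n)
      to′ = subst Fin q≡1+n ∘ to

      to′-injective : ∀ {x y} → to′ x ≡ to′ y → x ≡ y
      to′-injective = to-injective ∘ subst-injective q≡1+n

      to′-0≢w^ : (i : Fin (suc n)) → to′ 0# ≢ to′ (w ^ toℕ i)
      to′-0≢w^ i = w^≢0 (toℕ i) ∘ sym ∘ to′-injective

      w^n≡1 : w ^ n ≡ 1#
      w^n≡1
        with i , j , i<j , eq ← Fin.pigeonhole (ℕ.n<1+n n) (punchOut ∘ to′-0≢w^) =
        subst (λ e → w ^ e ≡ 1#) e≡n w^e
        where
        e = toℕ j ℕ.∸ toℕ i
        w^e : w ^ e ≡ 1#
        w^e = w^∸ i<j (to′-injective (Fin.punchOut-injective (to′-0≢w^ i) (to′-0≢w^ j) eq))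
        e≡n : e ≡ n
        e≡n = ℕ.≤-antisym
          (ℕ.≤-trans (ℕ.m∸n≤m (toℕ j) (toℕ i)) (Fin.toℕ≤pred[n] j))
          (ℕ.s≤s⁻¹ (subst (_≤ suc e) q≡1+n
            (order-bound e {{>-nonZero (ℕ.m<n⇒0<n∸m i<j)}} w^e)))

      w^m≡1⇒n∣m : ∀ m .{{_ : NonZero n}} → w ^ m ≡ 1# → n ∣ m
      w^m≡1⇒n∣m m eq = m%n≡0⇒n∣m m n (zero? (m % n) refl)
        where
        w^r : w ^ (m % n) ≡ 1#
        w^r = trans (sym (w^-cong-mod n m w^n≡1)) eq
        zero? : ∀ r → r ≡ m % n → m % n ≡ 0
        zero? zero    r≡ = sym r≡
        zero? (suc r) r≡ = contradiction
          (ℕ.s≤s⁻¹ (subst (_≤ suc (m % n)) q≡1+n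
            (order-bound (m % n) {{subst NonZero r≡ _}} w^r)))
          (ℕ.<⇒≱ (m%n<n m n))

    -1-power : q % 8 ≡ 1 → ∃ λ m → w ^ (m ℕ.* 4) ≡ - 1#
    -1-power q≡1 with m , -1≡w^m ← proj₂ prim (- 1#) (nonzero-neg (0≢1 ∘ sym)) = go (q / 8) refl
      where
      w^2m : w ^ (2 ℕ.* m) ≡ 1#
      w^2m = begin
        w ^ (2 ℕ.* m)              ≡⟨ cong (λ z → w ^ (m ℕ.+ z)) (ℕ.+-identityʳ m) ⟩
        w ^ (m ℕ.+ m)              ≡⟨ ^-homo-* w m m ⟩
        w ^ m * w ^ m              ≡⟨ cong₂ _*_ (sym -1≡w^m) (sym -1≡w^m) ⟩
        - 1# * - 1#                ≡⟨ neg*neg 1# 1# ⟩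
        1# * 1#                    ≡⟨ *-identityˡ 1# ⟩
        1#                         ∎
      q≡′ : q ≡ 1 ℕ.+ q / 8 ℕ.* 8
      q≡′ = trans (m≡m%n+[m/n]*n q 8) (cong (ℕ._+ q / 8 ℕ.* 8) q≡1)
      go : ∀ t → t ≡ q / 8 → ∃ λ m → w ^ (m ℕ.* 4) ≡ - 1#
      go zero    t≡ = contradiction (to-injective (fin1 (trans q≡′ (cong (λ z → 1 ℕ.+ z ℕ.* 8) (sym t≡))) _ _)) 0≢1
        where
        fin1 : ∀ {n} → n ≡ 1 → (i j : Fin n) → i ≡ j
        fin1 refl zero zero = refl
      go (suc t) t≡ = finish (*-cancelˡ-∣ {m = 4} {n = m} 2 (∣-trans (n∣m*n (suc t)) n∣2m))
        where
        n∣2m : suc t ℕ.* 8 ∣ 2 ℕ.* m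
        n∣2m = w^m≡1⇒n∣m {n = suc t ℕ.* 8} (trans q≡′ (cong (λ z → 1 ℕ.+ z ℕ.* 8) (sym t≡))) (2 ℕ.* m) w^2m
        finish : 4 ∣ m → ∃ λ k → w ^ (k ℕ.* 4) ≡ - 1#
        finish (divides k eq) = k , trans (cong (w ^_) (sym eq)) (sym -1≡w^m)

    abstract
      neg-power : q % 8 ≡ 1 → ∀ j → ∃ λ i → i % 4 ≡ j % 4 × w ^ i ≡ - (w ^ j)
      neg-power q≡1 j with m , eq ← -1-power q≡1 =
        j ℕ.+ m ℕ.* 4 , [m+kn]%n≡m%n j m 4 , (begin
          w ^ (j ℕ.+ m ℕ.* 4)        ≡⟨ ^-homo-* w j _ ⟩
          w ^ j * w ^ (m ℕ.* 4)      ≡⟨ cong (w ^ j *_) eq ⟩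
          w ^ j * - 1#               ≡⟨ *-comm (w ^ j) (- 1#) ⟩
          - 1# * w ^ j               ≡⟨ -1*x≈-x _ ⟩
          - (w ^ j)                  ∎)

even-power-mod-8 : ∀ {p r} → p % 4 ≡ 3 → 2 ∣ r → (p ℕ.^ r) % 8 ≡ 1
even-power-mod-8 {p} p≡3 (divides s refl) =
  trans (cong (_% 8) (trans (cong (p ℕ.^_) (ℕ.*-comm s 2)) (sym (ℕ.^-*-assoc p 2 s)))) (pow s)
  where
  open ≡-Reasoning
  t = p / 4
  u = 1 ℕ.+ 3 ℕ.* t ℕ.+ 2 ℕ.* (t ℕ.* t)

  expand : ∀ t → (3 ℕ.+ t ℕ.* 4) ℕ.* (3 ℕ.+ t ℕ.* 4)
               ≡ 1 ℕ.+ (1 ℕ.+ 3 ℕ.* t ℕ.+ 2 ℕ.* (t ℕ.* t)) ℕ.* 8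
  expand = solve-∀

  p² : p ℕ.^ 2 ≡ 1 ℕ.+ u ℕ.* 8
  p² = begin
    p ℕ.^ 2                                  ≡⟨ cong (p ℕ.*_) (ℕ.*-identityʳ p) ⟩
    p ℕ.* p                                  ≡⟨ cong₂ ℕ._*_ p≡ p≡ ⟩
    (3 ℕ.+ t ℕ.* 4) ℕ.* (3 ℕ.+ t ℕ.* 4)      ≡⟨ expand t ⟩
    1 ℕ.+ u ℕ.* 8                            ∎
    where
    p≡ : p ≡ 3 ℕ.+ t ℕ.* 4
    p≡ = trans (m≡m%n+[m/n]*n p 4) (cong (ℕ._+ t ℕ.* 4) p≡3)

  step : ∀ u n → (1 ℕ.+ u ℕ.* 8) ℕ.* n ≡ n ℕ.+ (u ℕ.* n) ℕ.* 8
  step = solve-∀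

  pow : ∀ s → ((p ℕ.^ 2) ℕ.^ s) % 8 ≡ 1
  pow zero    = refl
  pow (suc s) = begin
    (p ℕ.^ 2 ℕ.* n) % 8              ≡⟨ cong (λ z → (z ℕ.* n) % 8) p² ⟩
    ((1 ℕ.+ u ℕ.* 8) ℕ.* n) % 8      ≡⟨ cong (_% 8) (step u n) ⟩
    (n ℕ.+ (u ℕ.* n) ℕ.* 8) % 8      ≡⟨ [m+kn]%n≡m%n n (u ℕ.* n) 8 ⟩
    n % 8                            ≡⟨ pow s ⟩
    1                                ∎
    where n = (p ℕ.^ 2) ℕ.^ s

module _ {q : ℕ} (F : FiniteField q) where
  open FiniteField F
  open FieldFacts F
  open import Algebra.Properties.Group +-group using () renaming (⁻¹-anti-homo-// to neg-minus)

  paleyGraph : q % 4 ≡ 1 → Graph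
  paleyGraph q≡1 = record
    { V           = Carrier
    ; _∼_         = λ x y → x ≢ y × IsNonzeroSquare (x - y)
    ; ∼-sym       = λ {x} {y} (x≢y , sq) →
        x≢y ∘ sym , subst IsNonzeroSquare (neg-minus x y) (nonzeroSquare-neg q≡1 sq)
    ; ∼-irrefl    = λ (x≢x , _) → x≢x refl
    ; order       = q
    ; enumeration = enumeration
    }

  -- Exponents range over ℕ; as w has finite order q - 1 divisible by 4,
  -- integer exponents would give the same set.
  PeisertSet : Carrier → Carrier → Set
  PeisertSet w a = ∃ λ j → (j % 4 ≡ 0 ⊎ j % 4 ≡ 1) × a ≡ w ^ j

  peisertGraph : ∀ {p r} → p % 4 ≡ 3 → 2 ∣ r → q ≡ p ℕ.^ r →
                 (w : Carrier) → IsPrimitiveRoot w → Graph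
  peisertGraph {p} {r} p≡3 2∣r q≡p^r w prim = record
    { V           = Carrier
    ; _∼_         = λ x y → x ≢ y × PeisertSet w (x - y)
    ; ∼-sym       = λ {x} {y} (x≢y , s) →
        x≢y ∘ sym , subst (PeisertSet w) (neg-minus x y) (neg-closed s)
    ; ∼-irrefl    = λ (x≢x , _) → x≢x refl
    ; order       = q
    ; enumeration = enumeration
    }
    where
    neg-closed : ∀ {a} → PeisertSet w a → PeisertSet w (- a)
    neg-closed (j , j≡ , a≡)
      with i , i≡j , eq ← neg-power prim (trans (cong (_% 8) q≡p^r) (even-power-mod-8 {p} {r} p≡3 2∣r)) j =
      i , subst (λ z → z ≡ 0 ⊎ z ≡ 1) (sym i≡j) j≡ , trans (cong -_ a≡) (sym eq)

  data PaleyOrPeisert : Graph → Set₁ where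
    paley : ∀ {p r} → Prime p → r ≥ 1 → q ≡ p ℕ.^ r →
            (q≡1 : q % 4 ≡ 1) →
            PaleyOrPeisert (paleyGraph q≡1)
    peisert : ∀ {p r} → Prime p → (p≡3 : p % 4 ≡ 3) (2∣r : 2 ∣ r) (q≡p^r : q ≡ p ℕ.^ r) → q ≥ 5 →
              (w : Carrier) (prim : IsPrimitiveRoot w) →
              PaleyOrPeisert (peisertGraph {p} {r} p≡3 2∣r q≡p^r w prim)

{-# OPTIONS --safe #-}
module Submission where

-- Let χ be 1 on the connection set of Δ, -1 on its other nonzero elements and
-- 0 at 0, and let T(a) = Σ_u χ(u) χ(u + a). An additive bijection of the field
-- that preserves χ up to a sign preserves T. In the Paley case multiplication
-- by any c ≠ 0 is such a map; in the Peisert case multiplication by w² is one,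
-- and so is x ↦ w x^p, which permutes the four cyclotomic classes as
-- j ↦ 3j + 1. Either way T is constant on the nonzero elements, and since
-- Σ_a T(a) = (Σ χ)² = 0 and T(0) = q - 1, that constant is -1. This says that
-- the rows of the Seidel matrix of the cone over Δ are orthogonal, so for two
-- vertices of the cone the other q - 1 split evenly into those that agree and
-- those that disagree on them. These counts are the quotient numbers of Γ, and
-- connectedness, diameter and ample regularity are read off from 𝒬 q.

open import Defs
open import Algebra.Bundles using (CommutativeRing)
import Algebra.Properties.Semiring.Sum as SemiringSum
open import Data.Bool.Base using (Bool; true; false; not; _∧_; if_then_else_)
open import Data.Empty using (⊥-elim)
open import Data.Fin.Base as Fin using (Fin; zero; suc; fromℕ; inject₁; punchIn; punchOut)
open import Data.Fin.Patterns
open import Data.Fin.Permutation using (Permutation; permutation)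
import Data.Fin.Properties as Fin
open import Data.Integer.Base as ℤ using (ℤ; 0ℤ; 1ℤ; -1ℤ; _◃_)
import Data.Integer.Properties as ℤ
import Data.Integer.Tactic.RingSolver as ℤ-Solver
open import Data.List.Base using (List; []; _∷_; _++_; length; map; tabulate)
open import Data.List.Membership.Propositional using (_∈_)
open import Data.List.Membership.Propositional.Properties using (∈-map⁺; ∈-map⁻; ∈-++⁺ˡ; ∈-++⁺ʳ; ∈-++⁻; ∈-tabulate⁺)
open import Data.List.Properties using (length-map; length-++; length-tabulate)
import Data.List.Relation.Unary.All as All
import Data.List.Relation.Unary.AllPairs as AllPairs
open import Data.List.Relation.Unary.Any using (here; there)
open import Data.List.Relation.Unary.Unique.Propositional using (Unique)
import Data.List.Relation.Unary.Unique.Propositional.Properties as Unique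
open import Data.List.Relation.Binary.Permutation.Propositional using (↭-sym)
open import Data.List.Relation.Binary.Permutation.Propositional.Properties using (↭-length; ∈-resp-↭)
open import Data.Maybe.Base using (just; nothing)
open import Data.Maybe.Properties using (just-injective)
open import Data.Nat.Base as ℕ using (ℕ; zero; suc; _∸_; _≤_; _<_; z≤n; s≤s; _!)
open import Data.Nat.Combinatorics using (_C_; nCn≡1; nCk≡n!/k![n-k]!; k![n∸k]!∣n!)
open import Data.Nat.DivMod using (_/_; _%_; m/n≤m; m*n/n≡m; m/n*n≡m; m≡m%n+[m/n]*n; m%n<n; [m+kn]%n≡m%n; m≥n⇒m/n>0)
open import Data.Nat.Divisibility using (_∣_; divides; divides-refl; ∣-trans; ∣1⇒≡1; m∣m*n; n∣m*n; >⇒∤)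
open import Data.Nat.Primality using (Prime; euclidsLemma; prime⇒nonZero; prime⇒nonTrivial)
import Data.Nat.Properties as ℕ
open import Data.Nat.Tactic.RingSolver using (solve-∀)
open import Data.Product.Base using (∃; _×_; _,_; proj₁; proj₂)
open import Data.Sign.Base as Sign using (Sign)
import Data.Sign.Properties as Sign
open import Data.Sum.Base using (_⊎_; inj₁; inj₂; [_,_]′)
open import Data.Unit.Base using (⊤; tt)
open import Data.Vec.Base using (_∷_; []; lookup)
open import Function.Base using (_∘_; id)
open import Function.Bundles using (_↔_; mk⇔; Inverse; Equivalence)
open import Relation.Binary.Definitions using (DecidableEquality; tri<; tri≈; tri>)
open import Relation.Binary.PropositionalEquality
open import Relation.Nullary using (¬_; contradiction; Dec; yes; no; does; ¬?; _×-dec_; _⊎-dec_)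
open import Relation.Nullary.Decidable using (map′; dec-true; dec-false; from-yes)

open import Algebra.Properties.Group (CommutativeRing.+-group ℤ.+-*-commutativeRing) using ()
  renaming (∙-cancelˡ to ℤ-+-cancelˡ)
open SemiringSum (CommutativeRing.semiring ℤ.+-*-commutativeRing)
  using (sum; sum-cong-≗; sum-remove; sum-permute; ∑-distrib-+; ∑-comm; *-distribˡ-sum)

-- The Peisert set is a union of two cyclotomic classes of order four and not a subgroup, so χ is
-- not multiplicative there and T is handled only through symmetries of χ. Multiplication by w²
-- leaves two orbits on the nonzero elements, the even and the odd exponents; the map j ↦ pj + 1
-- changes parity because p is odd, and so joins them. The vanishing of Σ χ has two different
-- sources. In the Peisert case w² reverses χ, so the sum is its own negative. In the Paley case the
-- fact that a nonsquare multiplier reverses χ is itself deduced from Σ χ = 0, so that sum has to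
-- come from elsewhere, namely from counting square roots. In Γ a vertex has exactly one neighbour
-- over each other vertex of the cone, so every quotient number is a count of cone vertices. Only in
-- the row of P_2 does the sign of the neighbour vary in a way that matters, and this is the one
-- place where orthogonality enters.

-- Counting with `HasSize`

module _ {A : Set} where
  open Equivalence using (to; from)

  HasSize-resp-⇔ : ∀ {P Q : A → Set} {n} → (∀ {x} → P x → Q x) → (∀ {x} → Q x → P x) →
                   HasSize P n → HasSize Q n
  HasSize-resp-⇔ f g (xs , u , m , l) = xs , u , (λ x → mk⇔ (f ∘ to (m x)) (from (m x) ∘ g)) , l

  HasSize-∅ : ∀ {P : A → Set} → (∀ {x} → ¬ P x) → HasSize P 0
  HasSize-∅ ¬P = [] , AllPairs.[] , (λ x → mk⇔ (λ ()) (⊥-elim ∘ ¬P)) , refl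

  HasSize-singleton : ∀ a → HasSize {A} (_≡ a) 1
  HasSize-singleton a = a ∷ [] , All.[] AllPairs.∷ AllPairs.[] ,
    (λ x → mk⇔ (λ { (here eq) → eq ; (there ()) }) here) , refl

  HasSize-⊎ : ∀ {P Q : A → Set} {m n} → (∀ {x} → P x → ¬ Q x) →
              HasSize P m → HasSize Q n → HasSize (λ x → P x ⊎ Q x) (m ℕ.+ n)
  HasSize-⊎ disjoint (xs , u , mx , refl) (ys , v , my , refl) =
    xs ++ ys ,
    Unique.++⁺ u v (λ { {x} (x∈ , x∈′) → disjoint (to (mx x) x∈) (to (my x) x∈′) }) ,
    (λ x → mk⇔ ([ inj₁ ∘ to (mx x) , inj₂ ∘ to (my x) ]′ ∘ ∈-++⁻ xs)
               [ ∈-++⁺ˡ ∘ from (mx x) , ∈-++⁺ʳ xs ∘ from (my x) ]′) ,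
    length-++ xs

  HasSize-remove : ∀ {P : A → Set} {n a} → P a → HasSize P n → HasSize (λ x → P x × x ≢ a) (n ∸ 1)
  HasSize-remove {a = a} Pa (xs , u , m , refl)
    with ys , p ← extract (from (m a) Pa) =
    ys , AllPairs.tail u′ ,
    (λ x → mk⇔ (λ x∈ → to (m x) (∈-resp-↭ (↭-sym p) (there x∈)) , head∉tail u′ x∈ ∘ sym)
               (λ (Px , x≢a) → tail∈ (∈-resp-↭ p (from (m x) Px)) (x≢a ∘ sym))) ,
    cong (_∸ 1) (sym (↭-length p))
    where u′ = Unique-resp-↭ p u

  HasSize⇒¬ : ∀ {P : A → Set} {x} → HasSize P 0 → ¬ P x
  HasSize⇒¬ {x = x} ([] , _ , m , _) Px with () ← from (m x) Px

  HasSize⇒∃ : ∀ {P : A → Set} {n} → 0 < n → HasSize P n → ∃ P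
  HasSize⇒∃ () ([] , _ , _ , refl)
  HasSize⇒∃ _  (x ∷ _ , _ , m , _) = x , to (m x) (here refl)

  HasSize-finite : ∀ {n} → A ↔ Fin n → HasSize {A} (λ _ → ⊤) n
  HasSize-finite e =
    tabulate I.from ,
    Unique.tabulate⁺ (λ {i} {j} eq →
      trans (sym (I.strictlyInverseˡ i)) (trans (cong I.to eq) (I.strictlyInverseˡ j))) ,
    (λ x → mk⇔ (λ _ → tt) (λ _ → subst (_∈ tabulate I.from) (I.strictlyInverseʳ x) (∈-tabulate⁺ (I.to x)))) ,
    length-tabulate I.from
    where module I = Inverse e

  Unique-⊆⇒length≤ : ∀ {xs ys : List A} → Unique xs → (∀ {x} → x ∈ xs → x ∈ ys) → length xs ≤ length ys
  Unique-⊆⇒length≤ {[]}     _ _ = z≤n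
  Unique-⊆⇒length≤ {x ∷ xs} u xs⊆ys with zs , p ← extract (xs⊆ys (here refl)) =
    subst (suc (length xs) ≤_) (sym (↭-length p))
      (s≤s (Unique-⊆⇒length≤ (AllPairs.tail u)
        (λ z∈ → tail∈ (∈-resp-↭ p (xs⊆ys (there z∈))) (head∉tail u z∈))))

  HasSize-unique : ∀ {P : A → Set} {m n} → HasSize P m → HasSize P n → m ≡ n
  HasSize-unique (xs , u , mx , refl) (ys , v , my , refl) = ℕ.≤-antisym
    (Unique-⊆⇒length≤ u (λ {x} → from (my x) ∘ to (mx x)))
    (Unique-⊆⇒length≤ v (λ {x} → from (mx x) ∘ to (my x)))

module _ {A B : Set} where
  open Equivalence using (to; from)

  HasSize-map : ∀ {P : A → Set} {Q : B → Set} {n} (f : A → B) → (∀ {x y} → f x ≡ f y → x ≡ y) →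
                (∀ {x} → P x → Q (f x)) → (∀ {y} → Q y → ∃ λ x → P x × y ≡ f x) →
                HasSize P n → HasSize Q n
  HasSize-map {Q = Q} f f-inj sound complete (xs , u , m , refl) =
    map f xs , Unique.map⁺ f-inj u , (λ y → mk⇔ fwd bwd) , length-map f xs
    where
    fwd : ∀ {y} → y ∈ map f xs → Q y
    fwd y∈ with x , x∈ , refl ← ∈-map⁻ f y∈ = sound (to (m x) x∈)
    bwd : ∀ {y} → Q y → y ∈ map f xs
    bwd Qy with x , Px , refl ← complete Qy = ∈-map⁺ f (from (m x) Px)

-- Graphs with distribution diagram 𝒬 k

-- `P_5` meets only `P_2`, so it lies at distance 3 together with `P_3`: the six cells properly
-- refine the distance partition.
distanceFromRoot : Fin 6 → ℕ
distanceFromRoot = lookup (0 ∷ 1 ∷ 2 ∷ 3 ∷ 4 ∷ 3 ∷ [])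

module _ {k} (h>0 : 0 < (k ∸ 1) / 2) where
  open DistributionDiagram (𝒬 k) using () renaming (quotient to Q)

  k-1>0 : 0 < k ∸ 1
  k-1>0 = ℕ.≤-trans h>0 (m/n≤m (k ∸ 1) 2)

  k>0 : 0 < k
  k>0 = ℕ.≤-trans k-1>0 (ℕ.m∸n≤m k 1)

  distanceFromRoot≤4 : ∀ i → distanceFromRoot i ≤ 4
  distanceFromRoot≤4 0F = from-yes (0 ℕ.≤? 4)
  distanceFromRoot≤4 1F = from-yes (1 ℕ.≤? 4)
  distanceFromRoot≤4 2F = from-yes (2 ℕ.≤? 4)
  distanceFromRoot≤4 3F = from-yes (3 ℕ.≤? 4)
  distanceFromRoot≤4 4F = from-yes (4 ℕ.≤? 4)
  distanceFromRoot≤4 5F = from-yes (3 ℕ.≤? 4)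

  -- This is the source of the lower bound on distances: an edge needs a nonzero quotient number, so
  -- a walk gains at most one level per step. Only the zeros that forbid skipping a level matter.
  𝒬-step : ∀ i j → Q i j ≢ 0 → distanceFromRoot j ≤ suc (distanceFromRoot i)
  𝒬-step 0F 0F _ = z≤n
  𝒬-step 0F 1F _ = ℕ.≤-refl
  𝒬-step 0F 2F ≢0 = contradiction refl ≢0
  𝒬-step 0F 3F ≢0 = contradiction refl ≢0
  𝒬-step 0F 4F ≢0 = contradiction refl ≢0
  𝒬-step 0F 5F ≢0 = contradiction refl ≢0
  𝒬-step 1F 0F _ = z≤n
  𝒬-step 1F 1F _ = from-yes (1 ℕ.≤? 2)
  𝒬-step 1F 2F _ = ℕ.≤-refl
  𝒬-step 1F 3F ≢0 = contradiction refl ≢0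
  𝒬-step 1F 4F ≢0 = contradiction refl ≢0
  𝒬-step 1F 5F ≢0 = contradiction refl ≢0
  𝒬-step 2F 0F _ = z≤n
  𝒬-step 2F 1F _ = from-yes (1 ℕ.≤? 3)
  𝒬-step 2F 2F _ = from-yes (2 ℕ.≤? 3)
  𝒬-step 2F 3F _ = ℕ.≤-refl
  𝒬-step 2F 4F ≢0 = contradiction refl ≢0
  𝒬-step 2F 5F _ = ℕ.≤-refl
  𝒬-step 3F j  _ = distanceFromRoot≤4 j
  𝒬-step 4F j  _ = ℕ.m≤n⇒m≤1+n (distanceFromRoot≤4 j)
  𝒬-step 5F j  _ = distanceFromRoot≤4 j

  root-neighbour : ∀ j → Q 0F j ≢ 0 → j ≡ 1F
  root-neighbour 0F ≢0 = contradiction refl ≢0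
  root-neighbour 1F _  = refl
  root-neighbour 2F ≢0 = contradiction refl ≢0
  root-neighbour 3F ≢0 = contradiction refl ≢0
  root-neighbour 4F ≢0 = contradiction refl ≢0
  root-neighbour 5F ≢0 = contradiction refl ≢0

  distance-2 : ∀ i → distanceFromRoot i ≡ 2 → i ≡ 2F
  distance-2 2F _ = refl
  distance-2 3F ()
  distance-2 4F ()
  distance-2 5F ()

  module _ {G : Graph} where
    open Graph G

    _∷ʳ_ : ∀ {x y z n} → Walk G x y n → y ∼ z → Walk G x z (suc n)
    []      ∷ʳ e = e ∷ []
    (d ∷ w) ∷ʳ e = d ∷ (w ∷ʳ e)

    module Rooted (regular : QRegular G (𝒬 k)) (x : V) where
      part      = proj₁ (regular x)
      equitable = proj₁ (proj₂ (regular x))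
      root⇔     = proj₂ (proj₂ (proj₂ (regular x)))
      open IsEquitable equitable renaming (quotient to degree)

      part-x : part x ≡ 0F
      part-x = Equivalence.from (root⇔ x) refl

      adjacent⇒≢0 : ∀ {y z} → y ∼ z → Q (part y) (part z) ≢ 0
      adjacent⇒≢0 {y} {z} y∼z eq = HasSize⇒¬ (subst (HasSize _) eq (degree y (part z))) (y∼z , refl)

      neighbour-part : ∀ {y} → x ∼ y → part y ≡ 1F
      neighbour-part {y} x∼y =
        root-neighbour _ (subst (λ i → Q i (part y) ≢ 0) part-x (adjacent⇒≢0 x∼y))

      walk⇒≤ : ∀ {y z n} → Walk G y z n → distanceFromRoot (part z) ≤ n ℕ.+ distanceFromRoot (part y)
      walk⇒≤ []      = ℕ.≤-refl
      walk⇒≤ {y} (_∷_ {y = u} {n = n} e w) = ℕ.≤-trans (walk⇒≤ w)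
        (ℕ.≤-trans (ℕ.+-monoʳ-≤ n (𝒬-step (part y) (part u) (adjacent⇒≢0 e)))
                   (ℕ.≤-reflexive (ℕ.+-suc n _)))

      Reached : Fin 6 → Set
      Reached i = ∀ {y} → part y ≡ i → Walk G x y (distanceFromRoot i)

      -- The upper bound on distances: a positive quotient number from `i` to `j` gives every vertex
      -- of cell `i` a neighbour in cell `j`, and the walk to that neighbour is prolonged by one
      -- edge.
      extend : ∀ {i n} j → 0 < Q i j → (∀ {y} → part y ≡ j → Walk G x y n) →
               ∀ {y} → part y ≡ i → Walk G x y (suc n)
      extend j q>0 reach {y} refl with z , y∼z , z∈j ← HasSize⇒∃ q>0 (degree y j) =
        reach z∈j ∷ʳ ∼-sym y∼z

      reached : ∀ i → Reached i
      reached = λ { 0F → r₀ ; 1F → r₁ ; 2F → r₂ ; 3F → r₃ ; 4F → extend 3F k>0 r₃ ; 5F → extend 2F k>0 r₂ }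
        where
        r₀ : Reached 0F
        r₀ {y} eq = subst (λ z → Walk G x z 0) (sym (Equivalence.to (root⇔ y) eq)) []
        r₁ : Reached 1F
        r₁ = extend 0F (s≤s z≤n) r₀
        r₂ : Reached 2F
        r₂ = extend 1F h>0 r₁
        r₃ : Reached 3F
        r₃ = extend 2F k-1>0 r₂

      distance : ∀ y → Distance G x y (distanceFromRoot (part y))
      distance y = reached (part y) refl , λ m w →
        subst (_ ≤_) (trans (cong (λ i → m ℕ.+ distanceFromRoot i) part-x) (ℕ.+-identityʳ m)) (walk⇒≤ w)

      farthest : ∃ λ y → Distance G x y 4
      farthest with y , y∈4 ← nonempty 4F = y , subst (Distance G x y ∘ distanceFromRoot) y∈4 (distance y)

      valency : HasSize (x ∼_) k
      valency = HasSize-resp-⇔ proj₁ (λ x∼y → x∼y , neighbour-part x∼y)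
        (subst (λ i → HasSize (λ y → x ∼ y × part y ≡ 1F) (Q i 1F)) part-x (degree x 1F))

      -- Cell `1F` is exactly the neighbourhood of the root, so its column in the quotient matrix
      -- lists the numbers of common neighbours with the root; λ and μ are the entries in rows `1F`
      -- and `2F`.
      commonNeighbours : ∀ {y} → HasSize (CommonNeighbour G x y) (Q (part y) 1F)
      commonNeighbours {y} = HasSize-resp-⇔
        (λ {z} (y∼z , z∈1) → neighbour-of-root z∈1 , y∼z)
        (λ (x∼z , y∼z) → y∼z , neighbour-part x∼z)
        (degree y 1F)
        where
        neighbour-of-root : ∀ {z} → part z ≡ 1F → x ∼ z
        neighbour-of-root z∈1 with e ∷ [] ← reached 1F z∈1 = e

      distance2-part : ∀ {y} → Distance G x y 2 → part y ≡ 2F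
      distance2-part {y} (w , shortest) = distance-2 (part y)
        (ℕ.≤-antisym (proj₂ (distance y) 2 w) (shortest _ (proj₁ (distance y))))

    module _ (regular : QRegular G (𝒬 k)) where
      open Rooted regular

      𝒬-connected : Connected G
      𝒬-connected x y = _ , proj₁ (distance x y)

      𝒬-diameter : V → HasDiameter G 4
      𝒬-diameter x₀ = (λ x y → _ , distanceFromRoot≤4 (part x y) , distance x y) , x₀ , farthest x₀

      𝒬-amplyRegular : IsAmplyRegular G order k 0 ((k ∸ 1) / 2)
      𝒬-amplyRegular = record
        { order-v   = refl
        ; k-regular = valency
        ; adjacent  = λ {x} {y} x∼y →
            subst (λ i → HasSize (CommonNeighbour G x y) (Q i 1F)) (neighbour-part x x∼y) (commonNeighbours x)
        ; distance2 = λ {x} {y} d →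
            subst (λ i → HasSize (CommonNeighbour G x y) (Q i 1F)) (distance2-part x d) (commonNeighbours x)
        }

-- Conference graphs and their Taylor doubles

⟦_⟧ : Bool → ℤ
⟦ b ⟧ = if b then 1ℤ else 0ℤ

-- The bridge from integer sums, in which orthogonality is stated, to cardinalities. The size is
-- produced rather than prescribed, since its value is only determined afterwards.
HasSize-Fin : ∀ {n} {P : Fin n → Set} (P? : ∀ i → Dec (P i)) →
              ∃ λ m → HasSize P m × sum (λ i → ⟦ does (P? i) ⟧) ≡ ℤ.+ m
HasSize-Fin {zero}      P? = 0 , HasSize-∅ (λ { {()} }) , refl
HasSize-Fin {suc n} {P} P? with m , size , eq ← HasSize-Fin (P? ∘ suc) = extended (P? zero)
  where
  shifted : HasSize (λ i → ∃ λ j → i ≡ suc j × P i) m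
  shifted = HasSize-map suc Fin.suc-injective (λ Pi → _ , refl , Pi) (λ { (j , refl , Pi) → j , Pi , refl }) size
  extended : (d : Dec (P zero)) → ∃ λ m → HasSize P m × ⟦ does d ⟧ ℤ.+ sum (λ i → ⟦ does (P? (suc i)) ⟧) ≡ ℤ.+ m
  extended (yes P0) = suc m ,
    HasSize-resp-⇔ (λ { (inj₁ refl) → P0 ; (inj₂ (_ , _ , Pi)) → Pi })
                   (λ { {zero} _ → inj₁ refl ; {suc j} Pi → inj₂ (j , refl , Pi) })
                   (HasSize-⊎ (λ { refl (_ , () , _) }) (HasSize-singleton zero) shifted) ,
    cong (λ j → 1ℤ ℤ.+ j) eq
  extended (no ¬P0) = m ,
    HasSize-resp-⇔ (λ (_ , _ , Pi) → Pi)
                   (λ { {zero} P0 → contradiction P0 ¬P0 ; {suc j} Pi → j , refl , Pi }) shifted ,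
    trans (ℤ.+-identityˡ _) eq

entry : Bool → Sign → ℤ
entry diagonal s = if diagonal then 0ℤ else s ◃ 1

-- Summed over a row, this says that the inner product is the number of agreements minus the number
-- of disagreements, with the subtraction moved to the other side. The Boolean conjunctions are what
-- `does (agrees? x y s z)` reduces to.
entry-product : ∀ b c s t →
  entry b s ℤ.* entry c t ℤ.+ ⟦ (not b ∧ not c) ∧ does (s Sign.* t Sign.≟ Sign.-) ⟧
    ≡ ⟦ (not b ∧ not c) ∧ does (s Sign.* t Sign.≟ Sign.+) ⟧
entry-product true  c     s      t      = refl
entry-product false true  Sign.+ t      = refl
entry-product false true  Sign.- t      = refl
entry-product false false Sign.+ Sign.+ = refl
entry-product false false Sign.+ Sign.- = refl
entry-product false false Sign.- Sign.+ = refl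
entry-product false false Sign.- Sign.- = refl

opposite≢ : ∀ (i : Fin 2) → i ≢ Fin.opposite i
opposite≢ 0F ()
opposite≢ 1F ()

≢⇒opposite : ∀ {i j : Fin 2} → i ≢ j → j ≡ Fin.opposite i
≢⇒opposite {0F} {0F} i≢j = contradiction refl i≢j
≢⇒opposite {0F} {1F} i≢j = refl
≢⇒opposite {1F} {0F} i≢j = refl
≢⇒opposite {1F} {1F} i≢j = contradiction refl i≢j

sign-cancelˡ : ∀ s t → s Sign.* (s Sign.* t) ≡ t
sign-cancelˡ Sign.+ t = refl
sign-cancelˡ Sign.- t = Sign.opposite-involutive t

sign-cancelʳ : ∀ s t → (s Sign.* t) Sign.* t ≡ s
sign-cancelʳ s t = trans (Sign.*-assoc s t t) (trans (cong (s Sign.*_) (Sign.s*s≡+ t)) (Sign.*-identityʳ s))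

sign-twist : ∀ r s t → (r Sign.* (s Sign.* t)) Sign.* t ≡ r Sign.* s
sign-twist r s t = trans (Sign.*-assoc r (s Sign.* t) t) (cong (r Sign.*_) (sign-cancelʳ s t))

sign-regroup : ∀ r s t u → (r Sign.* (s Sign.* t)) Sign.* u ≡ (r Sign.* s) Sign.* (u Sign.* t)
sign-regroup r s t u = trans (cong (Sign._* u) (sym (Sign.*-assoc r s t)))
  (trans (Sign.*-assoc (r Sign.* s) t u) (cong ((r Sign.* s) Sign.*_) (Sign.*-comm t u)))

+≢- : Sign.+ ≢ Sign.-
+≢- ()

module Seidel (G : Graph) (_∼?_ : ∀ x y → Dec (Graph._∼_ G x y)) where
  open Graph G
  module E = Inverse enumeration

  _≟_ : DecidableEquality V
  x ≟ y = map′ (λ eq → trans (sym (E.strictlyInverseʳ x)) (trans (cong E.from eq) (E.strictlyInverseʳ y)))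
               (cong E.to) (E.to x Fin.≟ E.to y)

  -- In the Taylor double, vertices over distinct `x` and `y` are adjacent exactly when the product
  -- of their signs is `σ x y`. The diagonal value `Sign.-` is a default, masked by `entry` in
  -- `seidel` and by the inequalities in `Agrees`.
  σ : V → V → Sign
  σ x y = if does (x ∼? y) then Sign.+ else Sign.-

  σ-sym : ∀ x y → σ x y ≡ σ y x
  σ-sym x y with x ∼? y | y ∼? x
  ... | yes _ | yes _ = refl
  ... | no  _ | no  _ = refl
  ... | yes a | no ¬a = contradiction (∼-sym a) ¬a
  ... | no ¬a | yes a = contradiction (∼-sym a) ¬a

  -- The Seidel matrix with its signs reversed: 1 on edges, -1 on non-edges.
  seidel : V → V → ℤ
  seidel x z = entry (does (z ≟ x)) (σ x z)

  -- With zero diagonal and entries ±1 elsewhere, orthogonality of distinct rows makes `seidel` a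
  -- symmetric conference matrix.
  IsConference : Set
  IsConference = ∀ {x y} → x ≢ y → sum (λ i → seidel x (E.from i) ℤ.* seidel y (E.from i)) ≡ 0ℤ

  Agrees : V → V → Sign → V → Set
  Agrees x y s z = (z ≢ x × z ≢ y) × σ x z Sign.* σ y z ≡ s

  agrees? : ∀ x y s z → Dec (Agrees x y s z)
  agrees? x y s z = (¬? (z ≟ x) ×-dec ¬? (z ≟ y)) ×-dec (σ x z Sign.* σ y z Sign.≟ s)

  others : ∀ x → HasSize (_≢ x) (order ∸ 1)
  others x = HasSize-resp-⇔ proj₂ (tt ,_) (HasSize-remove tt (HasSize-finite enumeration))

  others₂ : ∀ {x y} → x ≢ y → HasSize (λ z → z ≢ x × z ≢ y) (order ∸ 1 ∸ 1)
  others₂ {x} x≢y = HasSize-remove (x≢y ∘ sym) (others x)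

  -- Two linear equations determine the counts for the two signs: together they exhaust the
  -- remaining vertices, and orthogonality makes them equal.
  agreement : IsConference → ∀ {x y} → x ≢ y → ∀ s → HasSize (Agrees x y s) ((order ∸ 1 ∸ 1) / 2)
  agreement conf {x} {y} x≢y = λ { Sign.+ → subst (HasSize _) (a≡h a≡b) Sa
                                 ; Sign.- → subst (HasSize _) (trans (sym a≡b) (a≡h a≡b)) Sb }
    where
    count : ∀ s → ∃ λ m → HasSize (Agrees x y s) m × sum (λ i → ⟦ does (agrees? x y s (E.from i)) ⟧) ≡ ℤ.+ m
    count s with m , size , eq ← HasSize-Fin (agrees? x y s ∘ E.from) =
      m , HasSize-map E.from
            (λ {i} {j} eq → trans (sym (E.strictlyInverseˡ i)) (trans (cong E.to eq) (E.strictlyInverseˡ j)))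
            id
            (λ {z} p → E.to z , subst (Agrees x y s) (sym (E.strictlyInverseʳ z)) p , sym (E.strictlyInverseʳ z))
            size , eq
    a  = proj₁ (count Sign.+)
    b  = proj₁ (count Sign.-)
    Sa = proj₁ (proj₂ (count Sign.+))
    Sb = proj₁ (proj₂ (count Sign.-))

    a+b : a ℕ.+ b ≡ order ∸ 1 ∸ 1
    a+b = HasSize-unique
      (HasSize-resp-⇔ [ proj₁ , proj₁ ]′ (λ {z} p → split (σ x z Sign.* σ y z) refl p)
        (HasSize-⊎ (λ (_ , +) (_ , -) → contradiction (trans (sym +) -) λ ()) Sa Sb))
      (others₂ x≢y)
      where
      split : ∀ {z} s → σ x z Sign.* σ y z ≡ s → z ≢ x × z ≢ y → Agrees x y Sign.+ z ⊎ Agrees x y Sign.- z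
      split Sign.+ eq p = inj₁ (p , eq)
      split Sign.- eq p = inj₂ (p , eq)

    a≡b : a ≡ b
    a≡b = ℤ.+-injective (begin
      ℤ.+ a                          ≡⟨ sym (proj₂ (proj₂ (count Sign.+))) ⟩
      sum agreeing
        ≡⟨ sum-cong-≗ (λ i → sym (entry-product (does (E.from i ≟ x)) (does (E.from i ≟ y)) _ _)) ⟩
      sum (λ i → product i ℤ.+ disagreeing i) ≡⟨ ∑-distrib-+ product disagreeing ⟩
      sum product ℤ.+ sum disagreeing         ≡⟨ cong₂ ℤ._+_ (conf x≢y) (proj₂ (proj₂ (count Sign.-))) ⟩
      0ℤ ℤ.+ ℤ.+ b                   ≡⟨ ℤ.+-identityˡ _ ⟩
      ℤ.+ b                          ∎)
      where
      open ≡-Reasoning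
      agreeing disagreeing product : Fin order → ℤ
      agreeing i    = ⟦ does (agrees? x y Sign.+ (E.from i)) ⟧
      disagreeing i = ⟦ does (agrees? x y Sign.- (E.from i)) ⟧
      product i     = seidel x (E.from i) ℤ.* seidel y (E.from i)

    a≡h : a ≡ b → a ≡ (order ∸ 1 ∸ 1) / 2
    a≡h eq = begin
      a              ≡⟨ sym (m*n/n≡m a 2) ⟩
      a ℕ.* 2 / 2      ≡⟨ cong (_/ 2) (trans (ℕ.*-comm a 2) (cong (a ℕ.+_) (ℕ.+-identityʳ a))) ⟩
      (a ℕ.+ a) / 2    ≡⟨ cong (λ m → (a ℕ.+ m) / 2) eq ⟩
      (a ℕ.+ b) / 2    ≡⟨ cong (_/ 2) a+b ⟩
      (order ∸ 1 ∸ 1) / 2 ∎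
      where open ≡-Reasoning

  -- The six-cell partition of the bipartite double of a Taylor double

  Γ : Graph
  Γ = bipartiteDouble (taylorDouble G)

  module Γ = Graph Γ

  base : Γ.V → V
  base ((x , _) , _) = x

  -- Four vertices of `Γ` lie over `z`; adjacency to a vertex over another base forces both the sign
  -- and the layer, so exactly one of them qualifies. At `z` equal to the base vertex the value is
  -- meaningless, and every use carries the inequality.
  neighbour : Γ.V → V → Γ.V
  neighbour ((x , δ) , i) z = (z , δ Sign.* σ x z) , Fin.opposite i

  ∼-neighbour : ∀ u {z} → z ≢ base u → u Γ.∼ neighbour u z
  ∼-neighbour ((x , δ) , i) {z} z≢x = (z≢x ∘ sym , adj (x ∼? z) (sign-cancelˡ δ (σ x z))) , opposite≢ i
    where
    adj : (d : Dec (x ∼ z)) → ∀ {s} → s ≡ (if does d then Sign.+ else Sign.-) →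
          (x ∼ z × s ≡ Sign.+) ⊎ (¬ (x ∼ z) × s ≡ Sign.-)
    adj (yes a) eq = inj₁ (a , eq)
    adj (no ¬a) eq = inj₂ (¬a , eq)

  ∼⇒neighbour : ∀ u {v} → u Γ.∼ v → base v ≢ base u × v ≡ neighbour u (base v)
  ∼⇒neighbour ((x , δ) , i) {(z , ε) , j} ((x≢z , adj) , i≢j) =
    x≢z ∘ sym ,
    cong₂ (λ ε j → (z , ε) , j)
      (trans (sym (sign-cancelˡ δ ε)) (cong (δ Sign.*_) (sign (x ∼? z) adj)))
      (≢⇒opposite i≢j)
    where
    sign : (d : Dec (x ∼ z)) → ∀ {s} → (x ∼ z × s ≡ Sign.+) ⊎ (¬ (x ∼ z) × s ≡ Sign.-) →
           s ≡ (if does d then Sign.+ else Sign.-)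
    sign (yes a) (inj₁ (_ , eq)) = eq
    sign (yes a) (inj₂ (¬a , _)) = contradiction a ¬a
    sign (no ¬a) (inj₁ (a , _))  = contradiction a ¬a
    sign (no ¬a) (inj₂ (_ , eq)) = eq

  HasSize-neighbours : ∀ u {R : Γ.V → Set} {n} →
    HasSize (λ z → z ≢ base u × R (neighbour u z)) n → HasSize (λ v → u Γ.∼ v × R v) n
  HasSize-neighbours u {R} = HasSize-map (neighbour u) (cong base)
    (λ (z≢x , r) → ∼-neighbour u z≢x , r)
    (λ {v} (u∼v , r) → let z≢x , eq = ∼⇒neighbour u u∼v in base v , (z≢x , subst R eq r) , eq)

  module _ (x₀ : V) (δ₀ : Sign) (i₀ : Fin 2) where

    -- A relational form of `part` whose constructors carry the defining conditions. In the layer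
    -- opposite to the root, `near` and `far` are the neighbours of the root and of its antipode;
    -- `mate` covers the two vertices over `x₀` there.
    data Cell : Γ.V → Fin 6 → Set where
      pole⁺ : ∀ {x ε i} → x ≡ x₀ → i ≡ i₀ → δ₀ Sign.* ε ≡ Sign.+ → Cell ((x , ε) , i) 0F
      near  : ∀ {x ε i} → x ≢ x₀ → i ≢ i₀ → (δ₀ Sign.* ε) Sign.* σ x₀ x ≡ Sign.+ → Cell ((x , ε) , i) 1F
      level : ∀ {x ε i} → x ≢ x₀ → i ≡ i₀ → Cell ((x , ε) , i) 2F
      far   : ∀ {x ε i} → x ≢ x₀ → i ≢ i₀ → (δ₀ Sign.* ε) Sign.* σ x₀ x ≡ Sign.- → Cell ((x , ε) , i) 3F
      pole⁻ : ∀ {x ε i} → x ≡ x₀ → i ≡ i₀ → δ₀ Sign.* ε ≡ Sign.- → Cell ((x , ε) , i) 4F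
      mate  : ∀ {x ε i} → x ≡ x₀ → i ≢ i₀ → Cell ((x , ε) , i) 5F

    cellIndex : Bool → Bool → Sign → Sign → Fin 6
    cellIndex true  true  Sign.+ _      = 0F
    cellIndex true  true  Sign.- _      = 4F
    cellIndex true  false _      _      = 5F
    cellIndex false true  _      _      = 2F
    cellIndex false false _      Sign.+ = 1F
    cellIndex false false _      Sign.- = 3F

    part : Γ.V → Fin 6
    part ((x , ε) , i) =
      cellIndex (does (x ≟ x₀)) (does (i Fin.≟ i₀)) (δ₀ Sign.* ε) ((δ₀ Sign.* ε) Sign.* σ x₀ x)

    cell : ∀ v → Cell v (part v)
    cell ((x , ε) , i) = go (x ≟ x₀) (i Fin.≟ i₀) refl refl
      where
      go : (d : Dec (x ≡ x₀)) (d′ : Dec (i ≡ i₀)) → ∀ {s t} →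
           δ₀ Sign.* ε ≡ s → (δ₀ Sign.* ε) Sign.* σ x₀ x ≡ t →
           Cell ((x , ε) , i) (cellIndex (does d) (does d′) s t)
      go (yes p) (yes p′) {Sign.+} s≡ _ = pole⁺ p p′ s≡
      go (yes p) (yes p′) {Sign.-} s≡ _ = pole⁻ p p′ s≡
      go (yes p) (no p′) _ _ = mate p p′
      go (no p) (yes p′) _ _ = level p p′
      go (no p) (no p′) {t = Sign.+} _ t≡ = near p p′ t≡
      go (no p) (no p′) {t = Sign.-} _ t≡ = far p p′ t≡

    Cell⇒part : ∀ {v c} → Cell v c → part v ≡ c
    Cell⇒part (pole⁺ {x} {i = i} p p′ s≡)
      rewrite dec-true (x ≟ x₀) p | dec-true (i Fin.≟ i₀) p′ | s≡ = refl
    Cell⇒part (near {x} {i = i} p p′ t≡)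
      rewrite dec-false (x ≟ x₀) p | dec-false (i Fin.≟ i₀) p′ | t≡ = refl
    Cell⇒part (level {x} {i = i} p p′)
      rewrite dec-false (x ≟ x₀) p | dec-true (i Fin.≟ i₀) p′ = refl
    Cell⇒part (far {x} {i = i} p p′ t≡)
      rewrite dec-false (x ≟ x₀) p | dec-false (i Fin.≟ i₀) p′ | t≡ = refl
    Cell⇒part (pole⁻ {x} {i = i} p p′ s≡)
      rewrite dec-true (x ≟ x₀) p | dec-true (i Fin.≟ i₀) p′ | s≡ = refl
    Cell⇒part (mate {x} {i = i} p p′)
      rewrite dec-true (x ≟ x₀) p | dec-false (i Fin.≟ i₀) p′ = refl

    part⇒Cell : ∀ {v c} → part v ≡ c → Cell v c
    part⇒Cell {v} refl = cell v

    transpose : ∀ {ε s} → δ₀ Sign.* ε ≡ s → ε ≡ δ₀ Sign.* s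
    transpose {ε} refl = sym (sign-cancelˡ δ₀ ε)

    twist₀ : ∀ t z → (δ₀ Sign.* (δ₀ Sign.* (t Sign.* σ x₀ z))) Sign.* σ x₀ z ≡ t
    twist₀ t z = trans (cong (Sign._* σ x₀ z) (sign-cancelˡ δ₀ _)) (sign-cancelʳ t (σ x₀ z))

    untwist : ∀ {ε t z} → (δ₀ Sign.* ε) Sign.* σ x₀ z ≡ t → ε ≡ δ₀ Sign.* (t Sign.* σ x₀ z)
    untwist {ε} {z = z} refl = transpose (sym (sign-cancelʳ (δ₀ Sign.* ε) (σ x₀ z)))

    toNeighbours : ∀ u c {n} → HasSize (λ z → z ≢ base u × Cell (neighbour u z) c) n →
                   HasSize (λ v → u Γ.∼ v × Cell v c) n
    toNeighbours u c = HasSize-neighbours u {λ v → Cell v c}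

    -- Everywhere except in the `level` row the sign condition on a neighbour is constant, absent,
    -- or concerns the single base vertex `x₀`, so counting the other base vertices is enough. From
    -- `level`, being near or far depends on `σ x₀ z Sign.* σ x z`, and `agreement` is required.
    row : IsConference → ∀ {u c} → Cell u c → ∀ j →
          HasSize (λ v → u Γ.∼ v × Cell v j) (DistributionDiagram.quotient (𝒬 (order ∸ 1)) c j)
    row conf {u} (pole⁺ {ε = ε} refl refl s≡) = λ
      { 0F → HasSize-∅ λ { (u∼v , pole⁺ p _ _) → proj₁ (∼⇒neighbour u u∼v) p }
      ; 1F → toNeighbours u 1F (HasSize-resp-⇔
               (λ {z} z≢x → z≢x , near z≢x (≢-sym (opposite≢ i₀)) (trans (sign-twist δ₀ ε (σ x₀ z)) s≡))
               proj₁ (others x₀))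
      ; 2F → HasSize-∅ λ { (u∼v , level _ i≡) → proj₂ u∼v (sym i≡) }
      ; 3F → toNeighbours u 3F (HasSize-∅ λ { {z} (_ , far _ _ t≡) →
               +≢- (trans (sym s≡) (trans (sym (sign-twist δ₀ ε (σ x₀ z))) t≡)) })
      ; 4F → HasSize-∅ λ { (u∼v , pole⁻ p _ _) → proj₁ (∼⇒neighbour u u∼v) p }
      ; 5F → HasSize-∅ λ { (u∼v , mate p _) → proj₁ (∼⇒neighbour u u∼v) p }
      }
    row conf {u} (pole⁻ {ε = ε} refl refl s≡) = λ
      { 0F → HasSize-∅ λ { (u∼v , pole⁺ p _ _) → proj₁ (∼⇒neighbour u u∼v) p }
      ; 1F → toNeighbours u 1F (HasSize-∅ λ { {z} (_ , near _ _ t≡) →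
               +≢- (trans (sym t≡) (trans (sign-twist δ₀ ε (σ x₀ z)) s≡)) })
      ; 2F → HasSize-∅ λ { (u∼v , level _ i≡) → proj₂ u∼v (sym i≡) }
      ; 3F → toNeighbours u 3F (HasSize-resp-⇔
               (λ {z} z≢x → z≢x , far z≢x (≢-sym (opposite≢ i₀)) (trans (sign-twist δ₀ ε (σ x₀ z)) s≡))
               proj₁ (others x₀))
      ; 4F → HasSize-∅ λ { (u∼v , pole⁻ p _ _) → proj₁ (∼⇒neighbour u u∼v) p }
      ; 5F → HasSize-∅ λ { (u∼v , mate p _) → proj₁ (∼⇒neighbour u u∼v) p }
      }
    row conf {u} (mate {i = i} refl i≢i₀) = λ
      { 0F → HasSize-∅ λ { (u∼v , pole⁺ p _ _) → proj₁ (∼⇒neighbour u u∼v) p }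
      ; 1F → toNeighbours u 1F (HasSize-∅ λ { (_ , near _ i≢ _) → i≢ opp≡ })
      ; 2F → toNeighbours u 2F (HasSize-resp-⇔ (λ z≢x → z≢x , level z≢x opp≡) proj₁ (others x₀))
      ; 3F → toNeighbours u 3F (HasSize-∅ λ { (_ , far _ i≢ _) → i≢ opp≡ })
      ; 4F → HasSize-∅ λ { (u∼v , pole⁻ p _ _) → proj₁ (∼⇒neighbour u u∼v) p }
      ; 5F → HasSize-∅ λ { (u∼v , mate p _) → proj₁ (∼⇒neighbour u u∼v) p }
      }
      where
      opp≡ : Fin.opposite i ≡ i₀
      opp≡ = sym (≢⇒opposite i≢i₀)
    row conf {u} (level {x} {ε} x≢x₀ refl) = λ
      { 0F → HasSize-∅ λ { (u∼v , pole⁺ _ i≡ _) → proj₂ u∼v (sym i≡) }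
      ; 1F → toNeighbours u 1F (HasSize-resp-⇔
               (λ { ((z≢x₀ , z≢x) , eq) → z≢x , near z≢x₀ opp≢ (product⁻ eq) })
               (λ { (z≢x , near z≢x₀ _ t≡) → (z≢x₀ , z≢x) , product⁺ t≡ })
               -- Which sign class is meant depends on `δ₀` and `ε`, but both have the same size.
               (agreement conf (x≢x₀ ∘ sym) ((δ₀ Sign.* ε) Sign.* Sign.+)))
      ; 2F → HasSize-∅ λ { (u∼v , level _ i≡) → proj₂ u∼v (sym i≡) }
      ; 3F → toNeighbours u 3F (HasSize-resp-⇔
               (λ { ((z≢x₀ , z≢x) , eq) → z≢x , far z≢x₀ opp≢ (product⁻ eq) })
               (λ { (z≢x , far z≢x₀ _ t≡) → (z≢x₀ , z≢x) , product⁺ t≡ })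
               (agreement conf (x≢x₀ ∘ sym) ((δ₀ Sign.* ε) Sign.* Sign.-)))
      ; 4F → HasSize-∅ λ { (u∼v , pole⁻ _ i≡ _) → proj₂ u∼v (sym i≡) }
      ; 5F → toNeighbours u 5F (HasSize-resp-⇔
               (λ { refl → x≢x₀ ∘ sym , mate refl opp≢ }) (λ { (_ , mate z≡x₀ _) → z≡x₀ })
               (HasSize-singleton x₀))
      }
      where
      opp≢ = ≢-sym (opposite≢ i₀)
      product⁺ : ∀ {z t} → (δ₀ Sign.* (ε Sign.* σ x z)) Sign.* σ x₀ z ≡ t →
                 σ x₀ z Sign.* σ x z ≡ (δ₀ Sign.* ε) Sign.* t
      product⁺ {z} refl = sym (trans
        (cong ((δ₀ Sign.* ε) Sign.*_) (sign-regroup δ₀ ε (σ x z) (σ x₀ z))) (sign-cancelˡ (δ₀ Sign.* ε) _))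
      product⁻ : ∀ {z t} → σ x₀ z Sign.* σ x z ≡ (δ₀ Sign.* ε) Sign.* t →
                 (δ₀ Sign.* (ε Sign.* σ x z)) Sign.* σ x₀ z ≡ t
      product⁻ {z} {t} eq = trans (sign-regroup δ₀ ε (σ x z) (σ x₀ z))
        (trans (cong ((δ₀ Sign.* ε) Sign.*_) eq) (sign-cancelˡ (δ₀ Sign.* ε) t))
    row conf {u} (near {x} {ε} {i} x≢x₀ i≢i₀ t≡) = λ
      { 0F → toNeighbours u 0F (HasSize-resp-⇔
               (λ { refl → x≢x₀ ∘ sym , pole⁺ refl opp≡ s≡ }) (λ { (_ , pole⁺ z≡x₀ _ _) → z≡x₀ })
               (HasSize-singleton x₀))
      ; 1F → toNeighbours u 1F (HasSize-∅ λ { (_ , near _ i≢ _) → i≢ opp≡ })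
      ; 2F → toNeighbours u 2F (HasSize-resp-⇔
               (λ (z≢x₀ , z≢x) → z≢x , level z≢x₀ opp≡) (λ { (z≢x , level z≢x₀ _) → z≢x₀ , z≢x })
               (others₂ (x≢x₀ ∘ sym)))
      ; 3F → toNeighbours u 3F (HasSize-∅ λ { (_ , far _ i≢ _) → i≢ opp≡ })
      ; 4F → toNeighbours u 4F (HasSize-∅ λ { (_ , pole⁻ refl _ s≡′) → +≢- (trans (sym s≡) s≡′) })
      ; 5F → toNeighbours u 5F (HasSize-∅ λ { (_ , mate _ i≢) → i≢ opp≡ })
      }
      where
      opp≡ : Fin.opposite i ≡ i₀
      opp≡ = sym (≢⇒opposite i≢i₀)
      s≡ : δ₀ Sign.* (ε Sign.* σ x x₀) ≡ Sign.+
      s≡ = trans (sym (Sign.*-assoc δ₀ ε _)) (trans (cong ((δ₀ Sign.* ε) Sign.*_) (σ-sym x x₀)) t≡)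
    row conf {u} (far {x} {ε} {i} x≢x₀ i≢i₀ t≡) = λ
      { 0F → toNeighbours u 0F (HasSize-∅ λ { (_ , pole⁺ refl _ s≡′) → +≢- (trans (sym s≡′) s≡) })
      ; 1F → toNeighbours u 1F (HasSize-∅ λ { (_ , near _ i≢ _) → i≢ opp≡ })
      ; 2F → toNeighbours u 2F (HasSize-resp-⇔
               (λ (z≢x₀ , z≢x) → z≢x , level z≢x₀ opp≡) (λ { (z≢x , level z≢x₀ _) → z≢x₀ , z≢x })
               (others₂ (x≢x₀ ∘ sym)))
      ; 3F → toNeighbours u 3F (HasSize-∅ λ { (_ , far _ i≢ _) → i≢ opp≡ })
      ; 4F → toNeighbours u 4F (HasSize-resp-⇔
               (λ { refl → x≢x₀ ∘ sym , pole⁻ refl opp≡ s≡ }) (λ { (_ , pole⁻ z≡x₀ _ _) → z≡x₀ })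
               (HasSize-singleton x₀))
      ; 5F → toNeighbours u 5F (HasSize-∅ λ { (_ , mate _ i≢) → i≢ opp≡ })
      }
      where
      opp≡ : Fin.opposite i ≡ i₀
      opp≡ = sym (≢⇒opposite i≢i₀)
      s≡ : δ₀ Sign.* (ε Sign.* σ x x₀) ≡ Sign.-
      s≡ = trans (sym (Sign.*-assoc δ₀ ε _)) (trans (cong ((δ₀ Sign.* ε) Sign.*_) (σ-sym x x₀)) t≡)

    Cell-size : ∀ c → HasSize (λ v → Cell v c) (DistributionDiagram.size (𝒬 (order ∸ 1)) c)
    Cell-size 0F = HasSize-resp-⇔
      (λ { refl → pole⁺ refl refl (sign-cancelˡ δ₀ Sign.+) })
      (λ { (pole⁺ refl refl s≡) → cong (λ ε → (x₀ , ε) , i₀) (transpose s≡) })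
      (HasSize-singleton ((x₀ , δ₀ Sign.* Sign.+) , i₀))
    Cell-size 1F = HasSize-map (λ z → (z , δ₀ Sign.* (Sign.+ Sign.* σ x₀ z)) , Fin.opposite i₀) (cong base)
      (λ {z} z≢x₀ → near z≢x₀ (≢-sym (opposite≢ i₀)) (twist₀ Sign.+ z))
      (λ { {(z , ε) , _} (near z≢x₀ i≢i₀ t≡) → z , z≢x₀ ,
             cong₂ (λ ε i → (z , ε) , i) (untwist t≡) (≢⇒opposite (≢-sym i≢i₀)) })
      (others x₀)
    Cell-size 2F = HasSize-resp-⇔
      (λ { (inj₁ (z≢x₀ , i≡i₀ , _)) → level z≢x₀ i≡i₀ ; (inj₂ (z≢x₀ , i≡i₀ , _)) → level z≢x₀ i≡i₀ })
      (λ { {(_ , Sign.+) , _} (level z≢x₀ i≡i₀) → inj₁ (z≢x₀ , i≡i₀ , refl)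
         ; {(_ , Sign.-) , _} (level z≢x₀ i≡i₀) → inj₂ (z≢x₀ , i≡i₀ , refl) })
      (HasSize-⊎ (λ { (_ , _ , refl) (_ , _ , ()) }) (layer Sign.+)
        -- `2 ℕ.* k` unfolds to `k ℕ.+ (k ℕ.+ 0)`, hence the trailing zero.
        (subst (HasSize _) (sym (ℕ.+-identityʳ (order ∸ 1))) (layer Sign.-)))
      where
      layer : ∀ s → HasSize (λ ((z , ε) , i) → z ≢ x₀ × i ≡ i₀ × ε ≡ s) (order ∸ 1)
      layer s = HasSize-map (λ z → (z , s) , i₀) (cong base) (λ z≢x₀ → z≢x₀ , refl , refl)
        (λ { {(z , _) , _} (z≢x₀ , refl , refl) → z , z≢x₀ , refl }) (others x₀)
    Cell-size 3F = HasSize-map (λ z → (z , δ₀ Sign.* (Sign.- Sign.* σ x₀ z)) , Fin.opposite i₀) (cong base)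
      (λ {z} z≢x₀ → far z≢x₀ (≢-sym (opposite≢ i₀)) (twist₀ Sign.- z))
      (λ { {(z , ε) , _} (far z≢x₀ i≢i₀ t≡) → z , z≢x₀ ,
             cong₂ (λ ε i → (z , ε) , i) (untwist t≡) (≢⇒opposite (≢-sym i≢i₀)) })
      (others x₀)
    Cell-size 4F = HasSize-resp-⇔
      (λ { refl → pole⁻ refl refl (sign-cancelˡ δ₀ Sign.-) })
      (λ { (pole⁻ refl refl s≡) → cong (λ ε → (x₀ , ε) , i₀) (transpose s≡) })
      (HasSize-singleton ((x₀ , δ₀ Sign.* Sign.-) , i₀))
    Cell-size 5F = HasSize-resp-⇔
      (λ { (inj₁ refl) → mate refl (≢-sym (opposite≢ i₀)) ; (inj₂ refl) → mate refl (≢-sym (opposite≢ i₀)) })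
      (λ { {(_ , Sign.+) , _} (mate refl i≢i₀) → inj₁ (cong ((x₀ , Sign.+) ,_) (≢⇒opposite (≢-sym i≢i₀)))
         ; {(_ , Sign.-) , _} (mate refl i≢i₀) → inj₂ (cong ((x₀ , Sign.-) ,_) (≢⇒opposite (≢-sym i≢i₀))) })
      (HasSize-⊎ (λ { refl () }) (HasSize-singleton ((x₀ , Sign.+) , Fin.opposite i₀))
                                 (HasSize-singleton ((x₀ , Sign.-) , Fin.opposite i₀)))

  conference⇒QRegular : IsConference → 0 < order ∸ 1 → QRegular Γ (𝒬 (order ∸ 1))
  conference⇒QRegular conf k>0 ((x₀ , δ₀) , i₀) =
    part x₀ δ₀ i₀ ,
    record
      { nonempty = λ c → let v , v∈c = HasSize⇒∃ (size>0 c) (Cell-size x₀ δ₀ i₀ c)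
                         in v , Cell⇒part x₀ δ₀ i₀ v∈c
      ; quotient = λ u c → HasSize-resp-⇔ (λ (u∼v , v∈c) → u∼v , Cell⇒part x₀ δ₀ i₀ v∈c)
                                          (λ (u∼v , eq) → u∼v , part⇒Cell x₀ δ₀ i₀ eq)
                                          (row x₀ δ₀ i₀ conf (cell x₀ δ₀ i₀ u) c)
      } ,
    (λ c → HasSize-resp-⇔ (Cell⇒part x₀ δ₀ i₀) (part⇒Cell x₀ δ₀ i₀) (Cell-size x₀ δ₀ i₀ c)) ,
    (λ v → mk⇔ (root v ∘ part⇒Cell x₀ δ₀ i₀)
               (λ { refl → Cell⇒part x₀ δ₀ i₀ (pole⁺ refl refl (Sign.s*s≡+ δ₀)) }))
    where
    root : ∀ v → Cell x₀ δ₀ i₀ v 0F → v ≡ ((x₀ , δ₀) , i₀)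
    root _ (pole⁺ refl refl s≡) =
      cong (λ ε → (x₀ , ε) , i₀) (trans (transpose x₀ δ₀ i₀ s≡) (Sign.*-identityʳ δ₀))
    size>0 : ∀ c → 0 < DistributionDiagram.size (𝒬 (order ∸ 1)) c
    size>0 0F = s≤s z≤n
    size>0 1F = k>0
    size>0 2F = ℕ.≤-trans k>0 (ℕ.m≤m+n (order ∸ 1) _)
    size>0 3F = k>0
    size>0 4F = s≤s z≤n
    size>0 5F = s≤s z≤n

-- Sums over a finite field

sum-const : ∀ n c → sum {n} (λ _ → c) ≡ ℤ.+ n ℤ.* c
sum-const zero    c = refl
sum-const (suc n) c = begin
  c ℤ.+ sum {n} (λ _ → c)  ≡⟨ cong (λ s → c ℤ.+ s) (sum-const n c) ⟩
  c ℤ.+ ℤ.+ n ℤ.* c        ≡⟨ sym (ℤ.suc-* (ℤ.+ n) c) ⟩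
  ℤ.+ suc n ℤ.* c          ∎
  where open ≡-Reasoning

injective⇒surjective : ∀ {n} {f : Fin n → Fin n} → (∀ {i j} → f i ≡ f j → i ≡ j) → ∀ y → ∃ λ x → f x ≡ y
injective⇒surjective {suc n} {f} f-inj y with Fin.any? (λ x → f x Fin.≟ y)
... | yes hit = hit
... | no miss = contradiction
  (Fin.injective⇒≤ {f = λ x → punchOut (missed x)}
    (λ {i} {j} eq → f-inj (Fin.punchOut-injective (missed i) (missed j) eq)))
  ℕ.1+n≰n
  where
  missed : ∀ x → y ≢ f x
  missed x eq = miss (x , sym eq)

module FieldSum {q : ℕ} (F : FiniteField q) where
  open FiniteField F
  open FieldFacts F using (_≟_; to-injective; from-injective)
  open Inverse enumeration using (to; from; strictlyInverseˡ; strictlyInverseʳ)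

  -- Finiteness supplies the inverse, so a map such as x ↦ w x^p can reindex a sum once it is known
  -- to be injective.
  reindexing : {φ : Carrier → Carrier} → (∀ {x y} → φ x ≡ φ y → x ≡ y) → Permutation q q
  reindexing {φ} φ-inj = permutation f (proj₁ ∘ onto) (proj₂ ∘ onto) (λ i → f-inj (proj₂ (onto (f i))))
    where
    f : Fin q → Fin q
    f = to ∘ φ ∘ from
    f-inj : ∀ {i j} → f i ≡ f j → i ≡ j
    f-inj = from-injective ∘ φ-inj ∘ to-injective
    onto = injective⇒surjective f-inj

  ∑ : (Carrier → ℤ) → ℤ
  ∑ f = sum (f ∘ from)

  ∑-cong : ∀ {f g} → (∀ x → f x ≡ g x) → ∑ f ≡ ∑ g
  ∑-cong eq = sum-cong-≗ (eq ∘ from)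

  ∑-+ : ∀ f g → ∑ (λ x → f x ℤ.+ g x) ≡ ∑ f ℤ.+ ∑ g
  ∑-+ f g = ∑-distrib-+ (f ∘ from) (g ∘ from)

  ∑-*ˡ : ∀ c f → ∑ (λ x → c ℤ.* f x) ≡ c ℤ.* ∑ f
  ∑-*ˡ c f = sym (*-distribˡ-sum c (f ∘ from))

  ∑-const : ∀ c → ∑ (λ _ → c) ≡ ℤ.+ q ℤ.* c
  ∑-const = sum-const q

  ∑-swap : ∀ (f : Carrier → Carrier → ℤ) → ∑ (λ x → ∑ (f x)) ≡ ∑ (λ y → ∑ (λ x → f x y))
  ∑-swap f = ∑-comm (λ i j → f (from i) (from j))

  ∑-reindex : ∀ {φ} → (∀ {x y} → φ x ≡ φ y → x ≡ y) → ∀ f → ∑ (f ∘ φ) ≡ ∑ f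
  ∑-reindex {φ} φ-inj f = trans
    (sum-cong-≗ (λ i → cong f (sym (strictlyInverseʳ (φ (from i))))))
    (sym (sum-permute (f ∘ from) (reindexing φ-inj)))

  δ : Carrier → Carrier → ℤ
  δ a x = ⟦ does (x ≟ a) ⟧

  δ-same : ∀ {a x} → x ≡ a → δ a x ≡ 1ℤ
  δ-same {a} {x} eq = cong ⟦_⟧ (dec-true (x ≟ a) eq)

  δ-other : ∀ {a x} → x ≢ a → δ a x ≡ 0ℤ
  δ-other {a} {x} neq = cong ⟦_⟧ (dec-false (x ≟ a) neq)

  ∑-δ : ∀ a → ∑ (δ a) ≡ 1ℤ
  ∑-δ a with m , size , eq ← HasSize-Fin (λ i → from i ≟ a) =
    trans eq (cong ℤ.+_ (HasSize-unique size (HasSize-resp-⇔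
      (λ i≡ → trans (cong from i≡) (strictlyInverseʳ a))
      (λ {i} from≡a → trans (sym (strictlyInverseˡ i)) (cong to from≡a))
      (HasSize-singleton (to a)))))

-- Cayley graphs on the additive group and their autocorrelation

module _ {q : ℕ} (F : FiniteField q) where
  open FiniteField F

  -- The symmetry argument has the exact type of a `∼-sym` field, so that the Paley and Peisert
  -- graphs are instances by definition.
  cayleyGraph : (D : Carrier → Set) →
                (∀ {x y} → x ≢ y × D (x - y) → y ≢ x × D (y - x)) → Graph
  cayleyGraph D D-sym = record
    { V           = Carrier
    ; _∼_         = λ x y → x ≢ y × D (x - y)
    ; ∼-sym       = D-sym
    ; ∼-irrefl    = λ (x≢x , _) → x≢x refl
    ; order       = q
    ; enumeration = enumeration
    }

module Autocorrelation {q : ℕ} (F : FiniteField q) {D : FiniteField.Carrier F → Set} (D? : ∀ x → Dec (D x)) where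
  open FiniteField F
  open FieldFacts F using (_≟_)
  open FieldSum F
  open import Algebra.Properties.Group +-group using ()
    renaming (∙-cancelˡ to +-cancelˡ; ⁻¹-injective to neg-injective; x∙y⁻¹≈ε⇒x≈y to x-y≡0⇒x≡y)

  χ : Carrier → ℤ
  χ x = entry (does (x ≟ 0#)) (if does (D? x) then Sign.+ else Sign.-)

  χ-zero : ∀ {x} → x ≡ 0# → χ x ≡ 0ℤ
  χ-zero {x} x≡0 rewrite dec-true (x ≟ 0#) x≡0 = refl

  χ-in : ∀ {x} → x ≢ 0# → D x → χ x ≡ 1ℤ
  χ-in {x} x≢0 d rewrite dec-false (x ≟ 0#) x≢0 | dec-true (D? x) d = refl

  χ-out : ∀ {x} → x ≢ 0# → ¬ D x → χ x ≡ -1ℤ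
  χ-out {x} x≢0 ¬d rewrite dec-false (x ≟ 0#) x≢0 | dec-false (D? x) ¬d = refl

  T : Carrier → ℤ
  T a = ∑ (λ u → χ u ℤ.* χ (u + a))

  χ²+δ : ∀ x → χ x ℤ.* χ x ℤ.+ δ 0# x ≡ 1ℤ
  χ²+δ x = go (does (x ≟ 0#)) (if does (D? x) then Sign.+ else Sign.-)
    where
    go : ∀ b s → entry b s ℤ.* entry b s ℤ.+ ⟦ b ⟧ ≡ 1ℤ
    go true  s      = refl
    go false Sign.+ = refl
    go false Sign.- = refl

  T-zero : T 0# ℤ.+ 1ℤ ≡ ℤ.+ q
  T-zero = begin
    T 0# ℤ.+ 1ℤ
      ≡⟨ cong₂ ℤ._+_ (∑-cong (λ u → cong (λ v → χ u ℤ.* χ v) (+-identityʳ u))) (sym (∑-δ 0#)) ⟩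
    ∑ (λ u → χ u ℤ.* χ u) ℤ.+ ∑ (δ 0#)                  ≡⟨ sym (∑-+ (λ u → χ u ℤ.* χ u) (δ 0#)) ⟩
    ∑ (λ u → χ u ℤ.* χ u ℤ.+ δ 0# u)                    ≡⟨ ∑-cong χ²+δ ⟩
    ∑ (λ _ → 1ℤ)                                        ≡⟨ ∑-const 1ℤ ⟩
    ℤ.+ q ℤ.* 1ℤ                                        ≡⟨ ℤ.*-identityʳ _ ⟩
    ℤ.+ q                                               ∎
    where open ≡-Reasoning

  -- Substitute `φ u` for the summation variable: `χ` occurs twice in each term, so the sign `e`
  -- cancels.
  T-invariant : ∀ (φ : Carrier → Carrier) (e : ℤ) → (∀ {x y} → φ x ≡ φ y → x ≡ y) → (∀ x y → φ (x + y) ≡ φ x + φ y) →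
                e ℤ.* e ≡ 1ℤ → (∀ x → χ (φ x) ≡ e ℤ.* χ x) → ∀ a → T (φ a) ≡ T a
  T-invariant φ e φ-inj φ-+ e²≡1 χφ a = begin
    T (φ a)                                             ≡⟨ sym (∑-reindex φ-inj (λ v → χ v ℤ.* χ (v + φ a))) ⟩
    ∑ (λ u → χ (φ u) ℤ.* χ (φ u + φ a))                 ≡⟨ ∑-cong (λ u → cong (λ v → χ (φ u) ℤ.* χ v) (sym (φ-+ u a))) ⟩
    ∑ (λ u → χ (φ u) ℤ.* χ (φ (u + a)))                 ≡⟨ ∑-cong (λ u → cong₂ ℤ._*_ (χφ u) (χφ (u + a))) ⟩
    ∑ (λ u → (e ℤ.* χ u) ℤ.* (e ℤ.* χ (u + a)))         ≡⟨ ∑-cong (λ u → regroup (χ u) (χ (u + a))) ⟩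
    T a                                                 ∎
    where
    open ≡-Reasoning
    shuffle : ∀ e x y → (e ℤ.* x) ℤ.* (e ℤ.* y) ≡ (e ℤ.* e) ℤ.* (x ℤ.* y)
    shuffle = ℤ-Solver.solve-∀
    regroup : ∀ x y → (e ℤ.* x) ℤ.* (e ℤ.* y) ≡ x ℤ.* y
    regroup x y = trans (shuffle e x y) (trans (cong (λ c → c ℤ.* (x ℤ.* y)) e²≡1) (ℤ.*-identityˡ _))

  module _ (∑χ≡0 : ∑ χ ≡ 0ℤ) where

    ∑T≡0 : ∑ T ≡ 0ℤ
    ∑T≡0 = begin
      ∑ (λ a → ∑ (λ u → χ u ℤ.* χ (u + a)))   ≡⟨ ∑-swap (λ a u → χ u ℤ.* χ (u + a)) ⟩
      ∑ (λ u → ∑ (λ a → χ u ℤ.* χ (u + a)))   ≡⟨ ∑-cong (λ u → ∑-*ˡ (χ u) (λ a → χ (u + a))) ⟩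
      ∑ (λ u → χ u ℤ.* ∑ (λ a → χ (u + a)))   ≡⟨ ∑-cong (λ u → trans (cong (λ s → χ u ℤ.* s) (translated u)) (ℤ.*-zeroʳ (χ u))) ⟩
      ∑ (λ _ → 0ℤ)                            ≡⟨ ∑-const 0ℤ ⟩
      ℤ.+ q ℤ.* 0ℤ                            ≡⟨ ℤ.*-zeroʳ (ℤ.+ q) ⟩
      0ℤ                                      ∎
      where
      open ≡-Reasoning
      translated : ∀ u → ∑ (λ a → χ (u + a)) ≡ 0ℤ
      translated u = trans (∑-reindex (λ {x} {y} → +-cancelˡ u x y) χ) ∑χ≡0

    -- Because `T 0#` is q - 1, the vanishing sum of `T` factors as `T 0# ℤ.* (T 1# ℤ.+ 1ℤ)`; the
    -- first factor is nonzero, as otherwise `q` would be 1.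
    T≡-1 : 1 < q → (∀ a → a ≢ 0# → T a ≡ T 1#) → ∀ a → a ≢ 0# → T a ≡ -1ℤ
    T≡-1 1<q T-const a a≢0 = trans (T-const a a≢0)
      ([ (λ T0≡0 → contradiction (ℤ.+-injective (trans (sym T-zero) (cong (λ i → i ℤ.+ 1ℤ) T0≡0))) (ℕ.<⇒≢ 1<q ∘ sym))
       , minus-one ]′
        (ℤ.i*j≡0⇒i≡0∨j≡0 (T 0#) product≡0))
      where
      open ≡-Reasoning
      -- `T` is written as a constant plus a multiple of `δ 0#`, so that its sum splits into two
      -- known sums.
      combine : ℤ → ℤ
      combine d = T 1# ℤ.+ (T 0# ℤ.- T 1#) ℤ.* d
      T-split : ∀ b → T b ≡ combine (δ 0# b)
      T-split b with b ≟ 0#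
      ... | yes refl = trans (split₁ (T 0#) (T 1#)) (cong combine (sym (δ-same {0#} refl)))
        where
        split₁ : ∀ s t → s ≡ t ℤ.+ (s ℤ.- t) ℤ.* 1ℤ
        split₁ = ℤ-Solver.solve-∀
      ... | no b≢0 = trans (T-const b b≢0) (trans (split₀ (T 0#) (T 1#)) (cong combine (sym (δ-other b≢0))))
        where
        split₀ : ∀ s t → t ≡ t ℤ.+ (s ℤ.- t) ℤ.* 0ℤ
        split₀ = ℤ-Solver.solve-∀
      factor : ∀ s t → s ℤ.* (t ℤ.+ 1ℤ) ≡ (s ℤ.+ 1ℤ) ℤ.* t ℤ.+ (s ℤ.- t) ℤ.* 1ℤ
      factor = ℤ-Solver.solve-∀
      product≡0 : T 0# ℤ.* (T 1# ℤ.+ 1ℤ) ≡ 0ℤ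
      product≡0 = begin
        T 0# ℤ.* (T 1# ℤ.+ 1ℤ)
          ≡⟨ factor (T 0#) (T 1#) ⟩
        (T 0# ℤ.+ 1ℤ) ℤ.* T 1# ℤ.+ (T 0# ℤ.- T 1#) ℤ.* 1ℤ
          ≡⟨ cong₂ (λ n s → n ℤ.* T 1# ℤ.+ (T 0# ℤ.- T 1#) ℤ.* s) T-zero (sym (∑-δ 0#)) ⟩
        ℤ.+ q ℤ.* T 1# ℤ.+ (T 0# ℤ.- T 1#) ℤ.* ∑ (δ 0#)
          ≡⟨ cong₂ ℤ._+_ (sym (∑-const (T 1#))) (sym (∑-*ˡ (T 0# ℤ.- T 1#) (δ 0#))) ⟩
        ∑ (λ _ → T 1#) ℤ.+ ∑ (λ b → (T 0# ℤ.- T 1#) ℤ.* δ 0# b)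
          ≡⟨ sym (∑-+ (λ _ → T 1#) (λ b → (T 0# ℤ.- T 1#) ℤ.* δ 0# b)) ⟩
        ∑ (λ b → T 1# ℤ.+ (T 0# ℤ.- T 1#) ℤ.* δ 0# b)
          ≡⟨ sym (∑-cong T-split) ⟩
        ∑ T
          ≡⟨ ∑T≡0 ⟩
        0ℤ ∎
      minus-one : T 1# ℤ.+ 1ℤ ≡ 0ℤ → T 1# ≡ -1ℤ
      minus-one eq = trans (sym (move (T 1#))) (cong (λ i → i ℤ.+ -1ℤ) eq)
        where
        move : ∀ t → t ℤ.+ 1ℤ ℤ.+ -1ℤ ≡ t
        move = ℤ-Solver.solve-∀

  module _ (D-sym : ∀ {x y} → x ≢ y × D (x - y) → y ≢ x × D (y - x)) where

    Δ : Graph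
    Δ = cayleyGraph F D D-sym

    _∼?_ : ∀ x y → Dec (Graph._∼_ (cone Δ) x y)
    nothing ∼? nothing = no λ ()
    nothing ∼? just _  = yes tt
    just _  ∼? nothing = yes tt
    just x  ∼? just y  = ¬? (x ≟ y) ×-dec D? (x - y)

    open Seidel (cone Δ) _∼?_ using (σ; seidel; IsConference) renaming (_≟_ to _≟ₘ_)

    seidel-χ : ∀ x z → seidel (just x) (just z) ≡ χ (x - z)
    seidel-χ x z with x ≟ z
    ... | yes refl = trans
      (cong (λ b → entry b (σ (just x) (just x))) (dec-true (just z ≟ₘ just x) refl))
      (sym (χ-zero (-‿inverseʳ x)))
    ... | no x≢z rewrite dec-false (just z ≟ₘ just x) (x≢z ∘ sym ∘ just-injective)
                       | dec-false ((x - z) ≟ 0#) (x≢z ∘ x-y≡0⇒x≡y x z)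
                       | dec-false (x ≟ z) x≢z = refl

    -- This is what the new vertex is for: it contributes 1 to the product of two ordinary rows and
    -- cancels the value -1 of `T`. Against its own row only the sum of `χ` remains.
    cone-conference : ∑ χ ≡ 0ℤ → (∀ a → a ≢ 0# → T a ≡ -1ℤ) → IsConference
    cone-conference ∑χ≡0 T≡ {x} {y} = conf x y
      where
      module M = Inverse (Graph.enumeration (cone Δ))
      minus-injective : ∀ a {x y} → a - x ≡ a - y → x ≡ y
      minus-injective a {x} {y} = neg-injective ∘ +-cancelˡ a (- x) (- y)
      ∑χ- : ∀ a → ∑ (λ z → χ (a - z)) ≡ 0ℤ
      ∑χ- a = trans (∑-reindex (minus-injective a) χ) ∑χ≡0
      telescope : ∀ a b z → (a - z) + (b - a) ≡ b - z
      telescope a b z = begin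
        (a - z) + (b - a)       ≡⟨ +-comm (a - z) (b - a) ⟩
        (b - a) + (a - z)       ≡⟨ +-assoc b (- a) (a - z) ⟩
        b + (- a + (a - z))     ≡⟨ cong (b +_) (sym (+-assoc (- a) a (- z))) ⟩
        b + ((- a + a) - z)     ≡⟨ cong (λ c → b + (c - z)) (-‿inverseˡ a) ⟩
        b + (0# - z)            ≡⟨ cong (b +_) (+-identityˡ (- z)) ⟩
        b - z                   ∎
        where open ≡-Reasoning

      conf : ∀ x y → x ≢ y → sum (λ i → seidel x (M.from i) ℤ.* seidel y (M.from i)) ≡ 0ℤ
      conf nothing  nothing  x≢y = contradiction refl x≢y
      -- The cone enumerates `nothing` at index zero, so `sum` unfolds to its term plus a sum over
      -- the field.
      conf nothing  (just b) _   = trans (ℤ.+-identityˡ _)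
        (trans (∑-cong (λ z → trans (ℤ.*-identityˡ _) (seidel-χ b z))) (∑χ- b))
      conf (just a) nothing  _   = trans
        (cong₂ ℤ._+_ (ℤ.*-zeroʳ 1ℤ) (∑-cong (λ z → trans (ℤ.*-identityʳ _) (seidel-χ a z))))
        (trans (ℤ.+-identityˡ _) (∑χ- a))
      conf (just a) (just b) a≢b = cong (λ s → 1ℤ ℤ.+ s) (begin
        ∑ (λ z → seidel (just a) (just z) ℤ.* seidel (just b) (just z))
          ≡⟨ ∑-cong (λ z → cong₂ ℤ._*_ (seidel-χ a z) (seidel-χ b z)) ⟩
        ∑ (λ z → χ (a - z) ℤ.* χ (b - z))
          ≡⟨ ∑-cong (λ z → cong (λ v → χ (a - z) ℤ.* χ v) (sym (telescope a b z))) ⟩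
        ∑ (λ z → χ (a - z) ℤ.* χ ((a - z) + (b - a)))
          ≡⟨ ∑-reindex (minus-injective a) (λ u → χ u ℤ.* χ (u + (b - a))) ⟩
        T (b - a)
          ≡⟨ T≡ (b - a) (a≢b ∘ cong just ∘ sym ∘ x-y≡0⇒x≡y b a) ⟩
        -1ℤ ∎)
        where open ≡-Reasoning

1<order : ∀ {q} → FiniteField q → 1 < q
1<order F = distinct (0≢1 ∘ to-injective)
  where
  open FiniteField F
  open FieldFacts F using (to-injective)
  distinct : ∀ {n} {i j : Fin n} → i ≢ j → 1 < n
  distinct {suc zero}    {zero} {zero} i≢j = contradiction refl i≢j
  distinct {suc (suc n)} _ = s≤s (s≤s z≤n)

-- Paley graphs

sum-≤0 : ∀ {n} (f : Fin n → ℤ) → (∀ i → f i ℤ.≤ 0ℤ) → sum f ℤ.≤ 0ℤ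
sum-≤0 {zero}  f f≤0 = ℤ.≤-refl
sum-≤0 {suc n} f f≤0 = ℤ.+-mono-≤ (f≤0 zero) (sum-≤0 (f ∘ suc) (f≤0 ∘ suc))

-- Each summand is at least the whole sum, because the remaining ones add up to at most zero.
sum≡0⇒all≡0 : ∀ {n} (f : Fin n → ℤ) → (∀ i → f i ℤ.≤ 0ℤ) → sum f ≡ 0ℤ → ∀ i → f i ≡ 0ℤ
sum≡0⇒all≡0 {suc n} f f≤0 sum≡0 i = ℤ.≤-antisym (f≤0 i) (begin
  0ℤ                                                  ≡⟨ sym sum≡0 ⟩
  sum f                                               ≡⟨ sum-remove {i = i} f ⟩
  f i ℤ.+ sum (f ∘ punchIn i)                         ≤⟨ ℤ.+-monoʳ-≤ (f i) (sum-≤0 (f ∘ punchIn i) (f≤0 ∘ punchIn i)) ⟩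
  f i ℤ.+ 0ℤ                                          ≡⟨ ℤ.+-identityʳ (f i) ⟩
  f i                                                 ∎)
  where open ℤ.≤-Reasoning

module Paley {q : ℕ} (F : FiniteField q) (q≡1 : q % 4 ≡ 1) where
  open FiniteField F
  open FieldFacts F
  open FieldSum F
  open Inverse enumeration using (to; from; strictlyInverseʳ)
  open import Algebra.Properties.CommutativeSemigroup
    (CommutativeRing.*-commutativeSemigroup commutativeRing) using (interchange)
  open import Algebra.Properties.Ring ring using ([y-z]x≈yx-zx)
  open import Algebra.Properties.Group +-group using ()
    renaming (x∙y⁻¹≈ε⇒x≈y to x-y≡0⇒x≡y; inverseˡ-unique to +-inverseˡ-unique)

  nonzeroSquare? : ∀ a → Dec (IsNonzeroSquare a)
  nonzeroSquare? a = ¬? (a ≟ 0#) ×-dec map′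
    (λ (i , eq) → from i , eq)
    (λ (s , eq) → to s , trans eq (sym (cong₂ _*_ (strictlyInverseʳ s) (strictlyInverseʳ s))))
    (Fin.any? (λ i → a ≟ (from i * from i)))

  open Autocorrelation F nonzeroSquare?

  square⁻¹ : ∀ {x s} → x * x ≡ s * s → x ≡ s ⊎ x ≡ - s
  square⁻¹ {x} {s} xx≡ss with x ≟ s | x ≟ (- s)
  ... | yes p | _     = inj₁ p
  ... | no _  | yes p = inj₂ p
  ... | no x≢s | no x≢-s = contradiction (begin
    (x - s) * (x + s)                    ≡⟨ distribˡ (x - s) x s ⟩
    (x - s) * x + (x - s) * s            ≡⟨ cong₂ _+_ ([y-z]x≈yx-zx x x s) ([y-z]x≈yx-zx s x s) ⟩
    (x * x - s * x) + (x * s - s * s)    ≡⟨ cong₂ (λ a b → (a - s * x) + (b - s * s)) xx≡ss (*-comm x s) ⟩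
    (s * s - s * x) + (s * x - s * s)    ≡⟨ +-assoc (s * s) (- (s * x)) _ ⟩
    s * s + (- (s * x) + (s * x - s * s)) ≡⟨ cong (s * s +_) (sym (+-assoc (- (s * x)) (s * x) _)) ⟩
    s * s + ((- (s * x) + s * x) - s * s) ≡⟨ cong (λ a → s * s + (a - s * s)) (-‿inverseˡ (s * x)) ⟩
    s * s + (0# - s * s)                 ≡⟨ cong (s * s +_) (+-identityˡ _) ⟩
    s * s - s * s                        ≡⟨ -‿inverseʳ (s * s) ⟩
    0#                                   ∎)
    (nonzero-* (x≢s ∘ x-y≡0⇒x≡y x s) (x≢-s ∘ +-inverseˡ-unique x s))
    where open ≡-Reasoning

  -- Zero has one root, a nonsquare none, and a nonzero square the two roots `s` and `- s`, which
  -- `x≢-x` keeps apart.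
  root-count : ∀ y → ∑ (λ x → δ y (x * x)) ≡ 1ℤ ℤ.+ χ y
  root-count y with y ≟ 0# | nonzeroSquare? y
  ... | yes refl | _ = begin
    ∑ (λ x → δ 0# (x * x))   ≡⟨ ∑-cong zero-root ⟩
    ∑ (δ 0#)                 ≡⟨ ∑-δ 0# ⟩
    1ℤ                       ≡⟨ cong (λ i → 1ℤ ℤ.+ i) (sym (χ-zero {0#} refl)) ⟩
    1ℤ ℤ.+ χ 0#              ∎
    where
    open ≡-Reasoning
    zero-root : ∀ x → δ 0# (x * x) ≡ δ 0# x
    zero-root x with x ≟ 0#
    ... | yes refl = trans (δ-same (zeroˡ 0#)) (sym (δ-same {0#} refl))
    ... | no x≢0   = trans (δ-other (nonzero-* x≢0 x≢0)) (sym (δ-other x≢0))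
  ... | no y≢0 | yes (_ , s , refl) = begin
    ∑ (λ x → δ (s * s) (x * x))        ≡⟨ ∑-cong two-roots ⟩
    ∑ (λ x → δ s x ℤ.+ δ (- s) x)      ≡⟨ ∑-+ (δ s) (δ (- s)) ⟩
    ∑ (δ s) ℤ.+ ∑ (δ (- s))            ≡⟨ cong₂ ℤ._+_ (∑-δ s) (∑-δ (- s)) ⟩
    1ℤ ℤ.+ 1ℤ                          ≡⟨ cong (λ i → 1ℤ ℤ.+ i) (sym (χ-in y≢0 (y≢0 , s , refl))) ⟩
    1ℤ ℤ.+ χ (s * s)                   ∎
    where
    open ≡-Reasoning
    s≢0 : s ≢ 0#
    s≢0 refl = y≢0 (zeroˡ 0#)
    two-roots : ∀ x → δ (s * s) (x * x) ≡ δ s x ℤ.+ δ (- s) x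
    two-roots x with x ≟ s | x ≟ (- s)
    ... | yes refl | _ = trans (δ-same {s * s} refl)
      (sym (cong₂ ℤ._+_ (δ-same {s} refl) (δ-other (x≢-x q≡1 s≢0 ∘ sym))))
    ... | no x≢s | yes refl = trans (δ-same (neg*neg s s))
      (sym (cong₂ ℤ._+_ (δ-other x≢s) (δ-same { - s} refl)))
    ... | no x≢s | no x≢-s = trans (δ-other ([ x≢s , x≢-s ]′ ∘ square⁻¹))
      (sym (cong₂ ℤ._+_ (δ-other x≢s) (δ-other x≢-s)))
  ... | no y≢0 | no ¬sq = begin
    ∑ (λ x → δ y (x * x))   ≡⟨ ∑-cong (λ x → δ-other (λ eq → ¬sq (y≢0 , x , sym eq))) ⟩
    ∑ (λ _ → 0ℤ)            ≡⟨ ∑-const 0ℤ ⟩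
    ℤ.+ q ℤ.* 0ℤ            ≡⟨ ℤ.*-zeroʳ (ℤ.+ q) ⟩
    0ℤ                      ≡⟨ cong (λ i → 1ℤ ℤ.+ i) (sym (χ-out y≢0 ¬sq)) ⟩
    1ℤ ℤ.+ χ y              ∎
    where open ≡-Reasoning

  δ-sym : ∀ a b → δ a b ≡ δ b a
  δ-sym a b with a ≟ b
  ... | yes refl = refl
  ... | no a≢b   = trans (δ-other (a≢b ∘ sym)) (sym (δ-other a≢b))

  -- Double counting of the pairs (x, y) with y = x²: by `x` there are `q` of them, by `y` there are
  -- `q` plus the sum of `χ`.
  ∑χ≡0 : ∑ χ ≡ 0ℤ
  ∑χ≡0 = ℤ-+-cancelˡ (ℤ.+ q ℤ.* 1ℤ) (∑ χ) 0ℤ (begin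
    ℤ.+ q ℤ.* 1ℤ ℤ.+ ∑ χ                 ≡⟨ cong (λ i → i ℤ.+ ∑ χ) (sym (∑-const 1ℤ)) ⟩
    ∑ (λ _ → 1ℤ) ℤ.+ ∑ χ                 ≡⟨ sym (∑-+ (λ _ → 1ℤ) χ) ⟩
    ∑ (λ y → 1ℤ ℤ.+ χ y)                 ≡⟨ ∑-cong (λ y → sym (root-count y)) ⟩
    ∑ (λ y → ∑ (λ x → δ y (x * x)))      ≡⟨ ∑-swap (λ y x → δ y (x * x)) ⟩
    ∑ (λ x → ∑ (λ y → δ y (x * x)))      ≡⟨ ∑-cong (λ x → trans (∑-cong (λ y → δ-sym y (x * x))) (∑-δ (x * x))) ⟩
    ∑ (λ _ → 1ℤ)                         ≡⟨ ∑-const 1ℤ ⟩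
    ℤ.+ q ℤ.* 1ℤ                         ≡⟨ sym (ℤ.+-identityʳ _) ⟩
    ℤ.+ q ℤ.* 1ℤ ℤ.+ 0ℤ                  ∎)
    where open ≡-Reasoning

  square-* : ∀ {x y} → IsNonzeroSquare x → IsNonzeroSquare y → IsNonzeroSquare (x * y)
  square-* (x≢0 , s , refl) (y≢0 , t , refl) = nonzero-* x≢0 y≢0 , s * t , interchange s s t t

  square-*⁻ : ∀ {x y} → y ≢ 0# → IsNonzeroSquare x → IsNonzeroSquare (x * y) → IsNonzeroSquare y
  square-*⁻ {y = y} y≢0 (x≢0 , s , refl) (_ , t , eq) = y≢0 , i * t , cancelˡ (s * s) x≢0 (begin
    s * s * y                      ≡⟨ eq ⟩
    t * t                          ≡⟨ sym (*-identityˡ _) ⟩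
    1# * (t * t)                   ≡⟨ cong (_* (t * t)) (sym (trans (cong₂ _*_ si≡1 si≡1) (*-identityˡ 1#))) ⟩
    (s * i) * (s * i) * (t * t)    ≡⟨ cong (_* (t * t)) (interchange s i s i) ⟩
    (s * s) * (i * i) * (t * t)    ≡⟨ *-assoc (s * s) (i * i) (t * t) ⟩
    s * s * ((i * i) * (t * t))    ≡⟨ cong (s * s *_) (interchange i i t t) ⟩
    s * s * ((i * t) * (i * t))    ∎)
    where
    open ≡-Reasoning
    i = inv s
    si≡1 : s * i ≡ 1#
    si≡1 = inv-* {s} (λ { refl → x≢0 (zeroˡ 0#) })

  χ-square-* : ∀ {c} → IsNonzeroSquare c → ∀ x → χ (c * x) ≡ 1ℤ ℤ.* χ x
  χ-square-* {c} sq@(c≢0 , _) x with x ≟ 0# | nonzeroSquare? x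
  ... | yes refl | _ = trans (χ-zero (zeroʳ c)) (sym (cong (λ i → 1ℤ ℤ.* i) (χ-zero {0#} refl)))
  ... | no x≢0 | yes sqx = trans (χ-in (nonzero-* c≢0 x≢0) (square-* sq sqx)) (sym (cong (λ i → 1ℤ ℤ.* i) (χ-in x≢0 sqx)))
  ... | no x≢0 | no ¬sqx = trans (χ-out (nonzero-* c≢0 x≢0) (¬sqx ∘ square-*⁻ x≢0 sq)) (sym (cong (λ i → 1ℤ ℤ.* i) (χ-out x≢0 ¬sqx)))

  -- The terms χ(cx) + χ(x) are nonpositive and sum to zero.
  χ-nonsquare-* : ∀ {c} → c ≢ 0# → ¬ IsNonzeroSquare c → ∀ x → χ (c * x) ≡ -1ℤ ℤ.* χ x
  χ-nonsquare-* {c} c≢0 ¬sq x = begin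
    χ (c * x)                            ≡⟨ sym (ℤ.+-identityʳ _) ⟩
    χ (c * x) ℤ.+ 0ℤ                     ≡⟨ cong (λ i → χ (c * x) ℤ.+ i) (sym (ℤ.+-inverseʳ (χ x))) ⟩
    χ (c * x) ℤ.+ (χ x ℤ.- χ x)          ≡⟨ sym (ℤ.+-assoc (χ (c * x)) (χ x) _) ⟩
    χ (c * x) ℤ.+ χ x ℤ.- χ x            ≡⟨ cong (λ i → i ℤ.- χ x) vanishes ⟩
    0ℤ ℤ.- χ x                           ≡⟨ ℤ.+-identityˡ _ ⟩
    ℤ.- χ x                              ≡⟨ sym (ℤ.-1*i≡-i (χ x)) ⟩
    -1ℤ ℤ.* χ x                          ∎
    where
    open ≡-Reasoning
    nonpositive : ∀ y → χ (c * y) ℤ.+ χ y ℤ.≤ 0ℤ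
    nonpositive y with y ≟ 0# | nonzeroSquare? y | nonzeroSquare? (c * y)
    ... | yes refl | _ | _ = ℤ.≤-reflexive (cong₂ ℤ._+_ (χ-zero (zeroʳ c)) (χ-zero {0#} refl))
    ... | no y≢0 | yes sqy | yes sqcy =
      contradiction (square-*⁻ c≢0 sqy (subst IsNonzeroSquare (*-comm c y) sqcy)) ¬sq
    ... | no y≢0 | yes sqy | no ¬sqcy = ℤ.≤-reflexive (cong₂ ℤ._+_ (χ-out (nonzero-* c≢0 y≢0) ¬sqcy) (χ-in y≢0 sqy))
    ... | no y≢0 | no ¬sqy | yes sqcy = ℤ.≤-reflexive (cong₂ ℤ._+_ (χ-in (nonzero-* c≢0 y≢0) sqcy) (χ-out y≢0 ¬sqy))
    -- The case of two nonsquares with nonsquare product is not refuted here; its value -2 is ruled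
    -- out only by `total`.
    ... | no y≢0 | no ¬sqy | no ¬sqcy =
      ℤ.≤-trans (ℤ.≤-reflexive (cong₂ ℤ._+_ (χ-out (nonzero-* c≢0 y≢0) ¬sqcy) (χ-out y≢0 ¬sqy))) ℤ.-≤+
    total : ∑ (λ y → χ (c * y) ℤ.+ χ y) ≡ 0ℤ
    total = trans (∑-+ (χ ∘ (c *_)) χ) (cong₂ ℤ._+_ (trans (∑-reindex (cancelˡ c c≢0) χ) ∑χ≡0) ∑χ≡0)
    vanishes : χ (c * x) ℤ.+ χ x ≡ 0ℤ
    vanishes = subst (λ y → χ (c * y) ℤ.+ χ y ≡ 0ℤ) (strictlyInverseʳ x)
      (sum≡0⇒all≡0 _ (nonpositive ∘ from) total (to x))

  T-constant : ∀ a → a ≢ 0# → T a ≡ T 1#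
  T-constant a a≢0 = trans (cong T (sym (*-identityʳ a))) (scaled (nonzeroSquare? a))
    where
    scaled : Dec (IsNonzeroSquare a) → T (a * 1#) ≡ T 1#
    scaled (yes sq) = T-invariant (a *_) 1ℤ (cancelˡ a a≢0) (distribˡ a) refl (χ-square-* sq) 1#
    scaled (no ¬sq) = T-invariant (a *_) -1ℤ (cancelˡ a a≢0) (distribˡ a) refl (χ-nonsquare-* a≢0 ¬sq) 1#

-- Peisert graphs

prime∤! : ∀ {p} → Prime p → ∀ {m} → m < p → ¬ (p ∣ m !)
prime∤! {p} pr {zero}  _   p∣1 = ℕ.nonTrivial⇒≢1 {{prime⇒nonTrivial pr}} (∣1⇒≡1 p∣1)
prime∤! {p} pr {suc m} m<p p∣m! =
  [ >⇒∤ m<p , prime∤! pr (ℕ.<⇒≤ m<p) ]′ (euclidsLemma (suc m) (m !) pr p∣m!)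

-- The prime divides p! = C · k! (p - k)!, but neither of the two factorials, whose factors are all
-- below `p`.
prime∣C : ∀ {p} → Prime p → ∀ {k} → 0 < k → k < p → p ∣ p C k
prime∣C {p} pr {k} 0<k k<p =
  [ id , (λ p∣k!j! → contradiction (euclidsLemma (k !) ((p ℕ.∸ k) !) pr p∣k!j!)
                                   [ prime∤! pr k<p , prime∤! pr j<p ]′) ]′
    (euclidsLemma (p C k) (k ! ℕ.* (p ℕ.∸ k) !) pr (subst (p ∣_) (sym C*k!j!≡p!) (n∣n! pr)))
  where
  j<p : p ℕ.∸ k < p
  j<p = ℕ.∸-monoʳ-< 0<k (ℕ.<⇒≤ k<p)
  instance _ = ℕ.m*n≢0 (k !) ((p ℕ.∸ k) !) {{k ℕ.!≢0}} {{(p ℕ.∸ k) ℕ.!≢0}}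
  C*k!j!≡p! : (p C k) ℕ.* (k ! ℕ.* (p ℕ.∸ k) !) ≡ p !
  C*k!j!≡p! = trans (cong (ℕ._* (k ! ℕ.* (p ℕ.∸ k) !)) (nCk≡n!/k![n-k]! (ℕ.<⇒≤ k<p)))
                    (m/n*n≡m (k![n∸k]!∣n! (ℕ.<⇒≤ k<p)))
  n∣n! : ∀ {n} → Prime n → n ∣ n !
  n∣n! {zero}  pr₀ = contradiction refl (ℕ.≢-nonZero⁻¹ 0 {{prime⇒nonZero pr₀}})
  n∣n! {suc n} _   = m∣m*n (n !)

-- The characteristic and additivity of the p-th power

module Frobenius {q : ℕ} (F : FiniteField q) {p r} (pr : Prime p) (q≡p^r : q ≡ p ℕ.^ r) where
  open FiniteField F
  open FieldFacts F
  open FieldSum F using (reindexing)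
  open Inverse enumeration using (to; from; strictlyInverseʳ)
  module FΣ = SemiringSum semiring
  open import Algebra.Properties.Semiring.Mult semiring
    using (×-homo-1; ×-assoc-*; ×-assocˡ; ×1-homo-*) renaming (_×_ to _·_)
  open import Algebra.Properties.CommutativeSemiring.Binomial
    (CommutativeRing.commutativeSemiring commutativeRing) using (binomialTerm) renaming (theorem to binomial-theorem)
  open import Algebra.Properties.Group +-group using () renaming (∙-cancelˡ to +-cancelˡ; ∙-cancelʳ to +-cancelʳ)
  open ≡-Reasoning

  -- Translation by `1#` permutes the field, so the sum of all elements is unchanged by adding
  -- `q · 1#`.
  q·1≡0 : q · 1# ≡ 0#
  q·1≡0 = +-cancelˡ (FΣ.sum from) (q · 1#) 0# (begin
    FΣ.sum from + q · 1#                         ≡⟨ cong (FΣ.sum from +_) (sym (FΣ.sum-replicate q)) ⟩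
    FΣ.sum from + FΣ.sum {q} (λ _ → 1#)             ≡⟨ sym (FΣ.∑-distrib-+ from (λ _ → 1#)) ⟩
    FΣ.sum (λ i → from i + 1#)                   ≡⟨ FΣ.sum-cong-≗ (λ i → sym (strictlyInverseʳ (from i + 1#))) ⟩
    FΣ.sum (λ i → from (to (from i + 1#)))       ≡⟨ sym (FΣ.sum-permute from (reindexing {_+ 1#} (λ {x} {y} → +-cancelʳ 1# x y))) ⟩
    FΣ.sum from                                  ≡⟨ sym (+-identityʳ _) ⟩
    FΣ.sum from + 0#                             ∎)

  p^·1≢0 : p · 1# ≢ 0# → ∀ n → (p ℕ.^ n) · 1# ≢ 0#
  p^·1≢0 p≢0 zero    eq = 0≢1 (sym (trans (sym (×-homo-1 1#)) eq))
  p^·1≢0 p≢0 (suc n) eq =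
    nonzero-* p≢0 (p^·1≢0 p≢0 n) (trans (sym (×1-homo-* p (p ℕ.^ n))) eq)

  -- `q · 1#` is the r-th power of `p · 1#`, and a field has no zero divisors.
  p·1≡0 : p · 1# ≡ 0#
  p·1≡0 with (p · 1#) ≟ 0#
  ... | yes eq = eq
  ... | no p≢0 = contradiction (trans (cong (_· 1#) (sym q≡p^r)) q·1≡0) (p^·1≢0 p≢0 r)

  p∣n⇒n·x≡0 : ∀ {n} → p ∣ n → ∀ x → n · x ≡ 0#
  p∣n⇒n·x≡0 {n} (divides d n≡d*p) x = begin
    n · x                   ≡⟨ cong (_· x) (trans n≡d*p (ℕ.*-comm d p)) ⟩
    (p ℕ.* d) · x           ≡⟨ sym (×-assocˡ x p d) ⟩
    p · (d · x)             ≡⟨ cong (p ·_) (sym (*-identityˡ (d · x))) ⟩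
    p · (1# * (d · x))      ≡⟨ sym (×-assoc-* p 1# (d · x)) ⟩
    (p · 1#) * (d · x)      ≡⟨ cong (_* (d · x)) p·1≡0 ⟩
    0# * (d · x)            ≡⟨ zeroˡ (d · x) ⟩
    0#                      ∎

  ^p-+ : ∀ x y → (x + y) ^ p ≡ x ^ p + y ^ p
  ^p-+ x y = go p refl
    where
    -- The exponent is generalised so that matching on `suc n` exposes the two end terms of the
    -- binomial sum; the inner ones vanish by `prime∣C`.
    go : ∀ n → n ≡ p → (x + y) ^ n ≡ x ^ n + y ^ n
    go zero    0≡p = contradiction (sym 0≡p) (ℕ.≢-nonZero⁻¹ p {{prime⇒nonZero pr}})
    go (suc n) refl = begin
      (x + y) ^ suc n                                  ≡⟨ binomial-theorem (suc n) x y ⟩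
      t zero + FΣ.sum (t ∘ suc)                           ≡⟨ cong (t zero +_) (FΣ.sum-init-last (t ∘ suc)) ⟩
      t zero + (FΣ.sum (t ∘ suc ∘ inject₁) + t (suc (fromℕ n)))
        ≡⟨ cong₂ (λ a b → t zero + (a + b)) (trans (FΣ.sum-cong-≗ middle) (FΣ.sum-replicate-zero n)) last-term ⟩
      t zero + (0# + x ^ suc n)                        ≡⟨ cong₂ _+_ first-term (+-identityˡ _) ⟩
      y ^ suc n + x ^ suc n                            ≡⟨ +-comm _ _ ⟩
      x ^ suc n + y ^ suc n                            ∎
      where
      t : Fin (suc (suc n)) → Carrier
      t = binomialTerm x y (suc n)
      first-term : t zero ≡ y ^ suc n
      first-term = trans (×-homo-1 _) (*-identityˡ _)
      last-term : t (suc (fromℕ n)) ≡ x ^ suc n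
      last-term = begin
        t (suc (fromℕ n))    ≡⟨ cong (λ k → (suc n C suc k) · (x ^ suc k * y ^ (n ℕ.∸ k))) (Fin.toℕ-fromℕ n) ⟩
        (suc n C suc n) · (x ^ suc n * y ^ (n ℕ.∸ n))  ≡⟨ cong₂ (λ c k → c · (x ^ suc n * y ^ k)) (nCn≡1 (suc n)) (ℕ.n∸n≡0 n) ⟩
        1 · (x ^ suc n * 1#) ≡⟨ ×-homo-1 _ ⟩
        x ^ suc n * 1#       ≡⟨ *-identityʳ _ ⟩
        x ^ suc n            ∎
      middle : ∀ i → t (suc (inject₁ i)) ≡ 0#
      middle i = p∣n⇒n·x≡0 (prime∣C pr (s≤s z≤n) (s≤s (subst (_< n) (sym (Fin.toℕ-inject₁ i)) (Fin.toℕ<n i)))) _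

-- Cyclotomic classes of order four and their symmetries

module Peisert {q : ℕ} (F : FiniteField q) {p r} (pr : Prime p) (p≡3 : p % 4 ≡ 3) (2∣r : 2 ∣ r)
               (q≡p^r : q ≡ p ℕ.^ r) (w : FiniteField.Carrier F) (prim : FiniteField.IsPrimitiveRoot F w) where
  open FiniteField F
  open FieldFacts F
  open FieldSum F
  open Frobenius F {r = r} pr q≡p^r using (^p-+)
  open import Algebra.Properties.Group +-group using ()
    renaming (x∙y⁻¹≈ε⇒x≈y to x-y≡0⇒x≡y; identityˡ-unique to +-identityˡ-unique)

  q%8≡1 : q % 8 ≡ 1
  q%8≡1 = trans (cong (_% 8) q≡p^r) (even-power-mod-8 {p} {r} p≡3 2∣r)

  m = q / 8

  q≡1+8m : q ≡ suc (m ℕ.* 8)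
  q≡1+8m = trans (m≡m%n+[m/n]*n q 8) (cong (ℕ._+ m ℕ.* 8) q%8≡1)

  w^≡1⇒4∣ : ∀ {e} → w ^ e ≡ 1# → 4 ∣ e
  w^≡1⇒4∣ {e} eq = ∣-trans (∣-trans (divides-refl 2) (n∣m*n m))
    (w^m≡1⇒n∣m prim q≡1+8m e {{ℕ.>-nonZero (ℕ.s≤s⁻¹ (subst (1 <_) q≡1+8m (1<order F)))}} eq)

  w^-shift : ∀ {i j} → i < j → w ^ i ≡ w ^ j → j % 4 ≡ i % 4
  w^-shift {i} {j} i<j eq with divides d j∸i≡ ← w^≡1⇒4∣ (w^∸ prim i<j eq) =
    trans (cong (_% 4) (trans (sym (ℕ.m+[n∸m]≡n (ℕ.<⇒≤ i<j))) (cong (i ℕ.+_) j∸i≡))) ([m+kn]%n≡m%n i d 4)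

  -- The order q - 1 of `w` is a multiple of 4. As `PeisertSet` asks only for some exponent,
  -- refuting membership rests on the class modulo 4 being well defined.
  exponent-mod-4 : ∀ i j → w ^ i ≡ w ^ j → i % 4 ≡ j % 4
  exponent-mod-4 i j eq with ℕ.<-cmp i j
  ... | tri< i<j _ _  = sym (w^-shift i<j eq)
  ... | tri≈ _ refl _ = refl
  ... | tri> _ _ j<i  = w^-shift j<i (sym eq)

  peisert? : ∀ a → Dec (PeisertSet F w a)
  peisert? a with a ≟ 0#
  ... | yes a≡0 = no λ (j , _ , a≡w^j) → w^≢0 prim j (trans (sym a≡w^j) a≡0)
  ... | no  a≢0 with j , a≡w^j ← proj₂ prim a a≢0 = map′
    (λ j∈ → j , j∈ , a≡w^j)
    (λ (i , i∈ , a≡w^i) → subst (λ c → c ≡ 0 ⊎ c ≡ 1) (exponent-mod-4 i j (trans (sym a≡w^i) a≡w^j)) i∈)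
    ((j % 4 ℕ.≟ 0) ⊎-dec (j % 4 ℕ.≟ 1))

  open Autocorrelation F peisert?

  -- Meant for residues modulo 4; the catch-all clause stands for 2 and 3.
  quartic : ℕ → ℤ
  quartic 0 = 1ℤ
  quartic 1 = 1ℤ
  quartic _ = -1ℤ

  χ-w^ : ∀ j → χ (w ^ j) ≡ quartic (j % 4)
  χ-w^ j with j % 4 in j≡
  ... | 0 = χ-in (w^≢0 prim j) (j , inj₁ j≡ , refl)
  ... | 1 = χ-in (w^≢0 prim j) (j , inj₂ j≡ , refl)
  ... | suc (suc c) = χ-out (w^≢0 prim j) λ (i , i∈ , eq) →
    [ (λ i≡0 → contradiction (trans (sym i≡0) (trans (exponent-mod-4 i j (sym eq)) j≡)) λ ())
    , (λ i≡1 → contradiction (trans (sym i≡1) (trans (exponent-mod-4 i j (sym eq)) j≡)) λ ()) ]′ i∈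

  quartic-step : ∀ (e : ℤ) (f : ℕ → ℕ) → (∀ c k → f (c ℕ.+ k ℕ.* 4) % 4 ≡ f c % 4) →
                 (∀ c → c < 4 → quartic (f c % 4) ≡ e ℤ.* quartic c) →
                 ∀ j → χ (w ^ f j) ≡ e ℤ.* χ (w ^ j)
  quartic-step e f periodic base j = begin
    χ (w ^ f j)                      ≡⟨ χ-w^ (f j) ⟩
    quartic (f j % 4)                ≡⟨ cong (λ i → quartic (f i % 4)) (m≡m%n+[m/n]*n j 4) ⟩
    quartic (f (j % 4 ℕ.+ j / 4 ℕ.* 4) % 4) ≡⟨ cong quartic (periodic (j % 4) (j / 4)) ⟩
    quartic (f (j % 4) % 4)          ≡⟨ base (j % 4) (m%n<n j 4) ⟩
    e ℤ.* quartic (j % 4)            ≡⟨ cong (λ i → e ℤ.* i) (sym (χ-w^ j)) ⟩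
    e ℤ.* χ (w ^ j)                  ∎
    where open ≡-Reasoning

  χ-step : ∀ (e : ℤ) (φ : Carrier → Carrier) → φ 0# ≡ 0# →
           (∀ j → χ (φ (w ^ j)) ≡ e ℤ.* χ (w ^ j)) → ∀ x → χ (φ x) ≡ e ℤ.* χ x
  χ-step e φ φ0≡0 on-powers x = cases (x ≟ 0#)
    where
    cases : Dec (x ≡ 0#) → χ (φ x) ≡ e ℤ.* χ x
    cases (yes x≡0) = trans (χ-zero (trans (cong φ x≡0) φ0≡0))
      (sym (trans (cong (λ i → e ℤ.* i) (χ-zero x≡0)) (ℤ.*-zeroʳ e)))
    cases (no x≢0) with j , eq ← proj₂ prim x x≢0 =
      subst (λ y → χ (φ y) ≡ e ℤ.* χ y) (sym eq) (on-powers j)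

  -- Adding 2 to the exponent exchanges the classes 0, 1 with 2, 3.
  χ-w² : ∀ x → χ (w ^ 2 * x) ≡ -1ℤ ℤ.* χ x
  χ-w² = χ-step -1ℤ (w ^ 2 *_) (zeroʳ (w ^ 2)) λ j → trans (cong χ (sym (^-homo-* w 2 j)))
    (quartic-step -1ℤ (2 ℕ.+_) (λ c k → [m+kn]%n≡m%n (2 ℕ.+ c) k 4) base j)
    where
    base : ∀ c → c < 4 → quartic ((2 ℕ.+ c) % 4) ≡ -1ℤ ℤ.* quartic c
    base 0 _ = refl
    base 1 _ = refl
    base 2 _ = refl
    base 3 _ = refl
    base (suc (suc (suc (suc _)))) (s≤s (s≤s (s≤s (s≤s ()))))

  t = p / 4

  p≡3+4t : p ≡ 3 ℕ.+ t ℕ.* 4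
  p≡3+4t = trans (m≡m%n+[m/n]*n p 4) (cong (ℕ._+ t ℕ.* 4) p≡3)

  -- Since p is 3 modulo 4, the p-th power alone sends the classes 0, 1 to 0, 3; the factor `w`
  -- moves these to 1, 0.
  φ : Carrier → Carrier
  φ x = w * x ^ p

  φ-w^ : ∀ j → φ (w ^ j) ≡ w ^ suc (j ℕ.* p)
  φ-w^ j = cong (w *_) (^-assocʳ w j p)

  φ-+ : ∀ x y → φ (x + y) ≡ φ x + φ y
  φ-+ x y = trans (cong (w *_) (^p-+ x y)) (distribˡ w (x ^ p) (y ^ p))

  φ-zero : φ 0# ≡ 0#
  φ-zero = +-identityˡ-unique (φ 0#) (φ 0#) (trans (sym (φ-+ 0# 0#)) (cong φ (+-identityˡ 0#)))

  -- An additive map with trivial kernel.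
  φ-injective : ∀ {x y} → φ x ≡ φ y → x ≡ y
  φ-injective {x} {y} eq with (x - y) ≟ 0#
  ... | yes x-y≡0 = x-y≡0⇒x≡y x y x-y≡0
  ... | no  x-y≢0 = contradiction (+-identityˡ-unique (φ (x - y)) (φ y) (begin
    φ (x - y) + φ y    ≡⟨ sym (φ-+ (x - y) y) ⟩
    φ (x - y + y)      ≡⟨ cong φ (trans (+-assoc x (- y) y) (trans (cong (x +_) (-‿inverseˡ y)) (+-identityʳ x))) ⟩
    φ x                ≡⟨ eq ⟩
    φ y                ∎)) (nonzero-* (proj₁ prim) (nonzero-^ p x-y≢0))
    where open ≡-Reasoning

  -- On exponents modulo 4, φ acts as j ↦ 3j + 1, swapping 0 with 1 and 2 with 3.
  χ-φ : ∀ x → χ (φ x) ≡ 1ℤ ℤ.* χ x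
  χ-φ = χ-step 1ℤ φ φ-zero λ j → trans (cong χ (φ-w^ j)) (quartic-step 1ℤ (λ j → suc (j ℕ.* p)) periodic base j)
    where
    periodic : ∀ c k → suc ((c ℕ.+ k ℕ.* 4) ℕ.* p) % 4 ≡ suc (c ℕ.* p) % 4
    periodic c k = trans (cong (_% 4) (expand c k p)) ([m+kn]%n≡m%n (suc (c ℕ.* p)) (k ℕ.* p) 4)
      where
      expand : ∀ c k p → suc ((c ℕ.+ k ℕ.* 4) ℕ.* p) ≡ suc (c ℕ.* p) ℕ.+ k ℕ.* p ℕ.* 4
      expand = solve-∀
    reduce : ∀ c → suc (c ℕ.* p) % 4 ≡ suc (c ℕ.* 3) % 4
    reduce c = trans (cong (λ p → suc (c ℕ.* p) % 4) p≡3+4t)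
      (trans (cong (_% 4) (expand c t)) ([m+kn]%n≡m%n (suc (c ℕ.* 3)) (c ℕ.* t) 4))
      where
      expand : ∀ c t → suc (c ℕ.* (3 ℕ.+ t ℕ.* 4)) ≡ suc (c ℕ.* 3) ℕ.+ c ℕ.* t ℕ.* 4
      expand = solve-∀
    base : ∀ c → c < 4 → quartic (suc (c ℕ.* p) % 4) ≡ 1ℤ ℤ.* quartic c
    base c c<4 = trans (cong quartic (reduce c)) (small c c<4)
      where
      small : ∀ c → c < 4 → quartic (suc (c ℕ.* 3) % 4) ≡ 1ℤ ℤ.* quartic c
      small 0 _ = refl
      small 1 _ = refl
      small 2 _ = refl
      small 3 _ = refl
      small (suc (suc (suc (suc _)))) (s≤s (s≤s (s≤s (s≤s ()))))

  w²-injective : ∀ {x y} → w ^ 2 * x ≡ w ^ 2 * y → x ≡ y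
  w²-injective = cancelˡ (w ^ 2) (w^≢0 prim 2)

  ∑χ≡0 : ∑ χ ≡ 0ℤ
  ∑χ≡0 = self-negative (begin
    ∑ χ                        ≡⟨ sym (∑-reindex w²-injective χ) ⟩
    ∑ (λ x → χ (w ^ 2 * x))    ≡⟨ ∑-cong χ-w² ⟩
    ∑ (λ x → -1ℤ ℤ.* χ x)      ≡⟨ ∑-*ˡ -1ℤ χ ⟩
    -1ℤ ℤ.* ∑ χ                ≡⟨ ℤ.-1*i≡-i (∑ χ) ⟩
    ℤ.- ∑ χ                    ∎)
    where
    open ≡-Reasoning
    self-negative : ∀ {i} → i ≡ ℤ.- i → i ≡ 0ℤ
    self-negative {ℤ.+ zero} _ = refl

  T-w² : ∀ a → T (w ^ 2 * a) ≡ T a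
  T-w² = T-invariant (w ^ 2 *_) -1ℤ w²-injective (distribˡ (w ^ 2)) refl χ-w²

  T-φ : ∀ a → T (φ a) ≡ T a
  T-φ = T-invariant φ 1ℤ φ-injective φ-+ refl χ-φ

  T-even-shift : ∀ n j → T (w ^ (n ℕ.* 2 ℕ.+ j)) ≡ T (w ^ j)
  T-even-shift zero    j = refl
  T-even-shift (suc n) j = trans (cong T (^-homo-* w 2 (n ℕ.* 2 ℕ.+ j))) (trans (T-w² _) (T-even-shift n j))

  T-w^ : ∀ j → T (w ^ j) ≡ T 1#
  T-w^ zero    = refl
  T-w^ (suc j) = begin
    -- The exponents j + 1 and jp + 1 differ by j(p - 1) = 2j(1 + 2t), which is even, and the second
    -- belongs to `φ (w ^ j)`.
    T (w ^ suc j)                                         ≡⟨ sym (T-even-shift (j ℕ.* suc (t ℕ.* 2)) (suc j)) ⟩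
    T (w ^ (j ℕ.* suc (t ℕ.* 2) ℕ.* 2 ℕ.+ suc j))
      ≡⟨ cong (λ e → T (w ^ e)) (trans (expand j t) (cong (λ p → suc (j ℕ.* p)) (sym p≡3+4t))) ⟩
    T (w ^ suc (j ℕ.* p))                                 ≡⟨ cong T (sym (φ-w^ j)) ⟩
    T (φ (w ^ j))                                         ≡⟨ T-φ (w ^ j) ⟩
    T (w ^ j)                                             ≡⟨ T-w^ j ⟩
    T 1#                                                  ∎
    where
    open ≡-Reasoning
    expand : ∀ j t → j ℕ.* suc (t ℕ.* 2) ℕ.* 2 ℕ.+ suc j ≡ suc (j ℕ.* (3 ℕ.+ t ℕ.* 4))
    expand = solve-∀

  T-constant : ∀ a → a ≢ 0# → T a ≡ T 1#
  T-constant a a≢0 with j , refl ← proj₂ prim a a≢0 = T-w^ j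

-- Bipartiteness and the common conclusion for both families

bipartiteDouble-bipartite : ∀ G → Bipartite (bipartiteDouble G)
bipartiteDouble-bipartite G = side , λ { {_ , i} {_ , j} (_ , i≢j) → i≢j ∘ isZero-injective i j }
  where
  isZero : Fin 2 → Bool
  isZero 0F = true
  isZero 1F = false
  side : Graph.V (bipartiteDouble G) → Bool
  side (_ , i) = isZero i
  isZero-injective : ∀ i j → isZero i ≡ isZero j → i ≡ j
  isZero-injective 0F 0F _ = refl
  isZero-injective 1F 1F _ = refl
  isZero-injective 0F 1F ()
  isZero-injective 1F 0F ()

module _ {q : ℕ} (F : FiniteField q) {D : FiniteField.Carrier F → Set} (D? : ∀ x → Dec (D x)) where
  open FiniteField F
  open FieldSum F using (∑)
  open Autocorrelation F D?

  cayley-proposition : (D-sym : ∀ {x y} → x ≢ y × D (x - y) → y ≢ x × D (y - x)) →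
    ∑ χ ≡ 0ℤ → (∀ a → a ≢ 0# → T a ≡ T 1#) → q ≢ 2 →
    let Γ = bipartiteDouble (taylorExtension (cayleyGraph F D D-sym))
    in Connected Γ
     × Bipartite Γ
     × HasDiameter Γ 4
     × IsAmplyRegular Γ (4 ℕ.* (q ℕ.+ 1)) q 0 ((q ∸ 1) / 2)
     × QRegular Γ (𝒬 q)
  cayley-proposition D-sym ∑χ≡0 T-const q≢2 =
    𝒬-connected h>0 regular ,
    bipartiteDouble-bipartite (taylorExtension (cayleyGraph F D D-sym)) ,
    𝒬-diameter h>0 regular ((nothing , Sign.+) , 0F) ,
    subst (λ v → IsAmplyRegular Γ v q 0 ((q ∸ 1) / 2)) (count q) (𝒬-amplyRegular h>0 regular) ,
    regular
    where
    Γ = bipartiteDouble (taylorExtension (cayleyGraph F D D-sym))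
    q>2 : 2 < q
    q>2 = ℕ.≤∧≢⇒< (1<order F) (q≢2 ∘ sym)
    -- Walks from the root reach `P_2` through `P_1`, which takes a positive quotient number from
    -- `P_2` back to `P_1`.
    h>0 : 0 < (q ∸ 1) / 2
    h>0 = m≥n⇒m/n>0 (ℕ.∸-monoˡ-≤ 1 q>2)
    regular : QRegular Γ (𝒬 q)
    regular = Seidel.conference⇒QRegular (cone (cayleyGraph F D D-sym)) (_∼?_ D-sym)
      (cone-conference D-sym ∑χ≡0 (T≡-1 ∑χ≡0 (1<order F) T-const)) (ℕ.<⇒≤ (1<order F))
    -- The left side is the computed order of `Γ`: `suc` from the cone, one factor 2 from each of
    -- the two doubles.
    count : ∀ n → suc n ℕ.* 2 ℕ.* 2 ≡ 4 ℕ.* (n ℕ.+ 1)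
    count = solve-∀

open import Data.Nat.Base using (_+_; _*_)

proposition3p1 : ∀ {q : ℕ} (F : FiniteField q) (Δ : Graph) → PaleyOrPeisert F Δ →
    let Σ = taylorExtension Δ
        Γ = bipartiteDouble Σ
    in Connected Γ
     × Bipartite Γ
     × HasDiameter Γ 4
     × IsAmplyRegular Γ (4 * (q + 1)) q 0 ((q ∸ 1) / 2)
     × QRegular Γ (𝒬 q)
proposition3p1 F Δ (paley _ _ _ q≡1) =
  cayley-proposition F nonzeroSquare? (Graph.∼-sym Δ) ∑χ≡0 T-constant
    (λ q≡2 → contradiction (trans (sym q≡1) (cong (_% 4) q≡2)) λ ())
  where open Paley F q≡1
proposition3p1 F Δ (peisert {p} {r} pr p≡3 2∣r q≡p^r _ w prim) =
  cayley-proposition F peisert? (Graph.∼-sym Δ) ∑χ≡0 T-constant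
    (λ q≡2 → contradiction (trans (sym q%8≡1) (cong (_% 8) q≡2)) λ ())
  where open Peisert F {r = r} pr p≡3 2∣r q≡p^r w prim
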